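{- Let $n$ be a positive integer and $x=(x_1,\dots,x_n)$. Then $$P^{\mathrm{C}_n}_{(1^n)}(x;t,0)=\sum_{y\in\mathbb{Z}}t^{2y^2-y}\bigl(\dot e_{n-4y}(x)-\dot e_{n+2-4y}(x)\bigr)$$ and $$P^{\mathrm{C}_n}_{(1^n)}(x;t,t)=\sum_{\substack{y\in\mathbb{Z}\\ y\ \mathrm{even}}}t^{y^2-y}\bigl(\dot e_{n-2y}(x)-\dot e_{n+2-2y}(x)\bigr).$$
   Context: $\dot e_r(x)=e_r(x_1,x_1^{ -1},\dots,x_n,x_n^{ -1})$ is the $r$-th elementary symmetric function in $2n$ variables, equal to $0$ for $r<0$ or $r>2n$. $(1^n)$ is the partition with $n$ parts equal to $1$. For a partition $\lambda$, $l(\lambda)$ is the number of parts and $m_i(\lambda)$ the multiplicity of parts equal to $i$; $(a;t)_m=\prod_{i=0}^{m-1}(1-at^i)$; $v_\lambda(t)=\frac{(t;t)_{n-l(\lambda)}}{(1-t)^{n-l(\lambda)}}\prod_{i\ge1}\frac{(t;t)_{m_i(\lambda)}}{(1-t)^{m_i(\lambda)}}$. Let $W=S_n\ltimes(\mathbb{Z}/2\mathbb{Z})^n$ act on rational functions in $x$ by permuting the $x_i$ and by $x_i\mapsto x_i^{ -1}$. For $l(\lambda)\le n$ the $\mathrm{BC}_n$ Hall–Littlewood polynomial is $$P^{\mathrm{BC}_n}_{\lambda}(x;t,s_1,s_2)=\frac{1}{(s_1s_2;t)_{n-l(\lambda)}v_\lambda(t)}\sum_{w\in W}w\Biggl(\prod_{i=1}^n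 x_i^{ -\lambda_i}\frac{(1-s_1x_i)(1-s_2x_i)}{1-x_i^2}\prod_{1\le i<j\le n}\frac{(tx_i-x_j)(1-tx_ix_j)}{(x_i-x_j)(1-x_ix_j)}\Biggr),$$ and the $\mathrm{C}_n$ Hall–Littlewood polynomial is $P^{\mathrm{C}_n}_\lambda(x;t,s)=P^{\mathrm{BC}_n}_\lambda(x;t,s^{1/2},-s^{1/2})$. -}

module Defs where

open import Level using (_⊔_)
open import Algebra.Apartness.Bundles using (HeytingField; HeytingCommutativeRing)
open import Algebra.Bundles using (CommutativeRing; Monoid; Semiring)
open import Data.Bool.Base using (Bool; true; false; if_then_else_)
open import Data.Fin.Base as Fin using (Fin; toℕ)
import Data.Fin.Properties as Fin
open import Data.Fin.Permutation as Perm using (Permutation′; _⟨$⟩ʳ_)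
open import Data.Integer.Base as ℤ using (ℤ; +_; -[1+_]; ∣_∣)
open import Data.Integer.Divisibility.Signed as ℤ using (_∣_; _∣?_)
open import Data.List.Base as List using (List; []; _∷_; _++_)
open import Data.List.Relation.Unary.All using (All)
import Data.List.Relation.Unary.All.Properties as All
open import Data.List.Relation.Unary.Linked using (Linked; []; [-]; _∷_)
open import Data.Nat.Base as ℕ using (ℕ; zero; suc; z≤n; s≤s)
import Data.Nat.Properties as ℕ
open import Data.Product.Base using (_×_; _,_; proj₁; proj₂; ∃)
open import Data.Vec.Base as Vec using (Vec)
open import Function.Base using (_∘_)
open import Relation.Binary.PropositionalEquality.Core using (_≡_; _≢_; refl; subst; sym; cong)
open import Relation.Nullary using (Dec; yes; no)
open import Relation.Unary using (Pred; Decidable)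

record Partition : Set where
  field
    parts      : List ℕ
    decreasing : Linked ℕ._≥_ parts
    positive   : All (ℕ._> 0) parts

  len : ℕ
  len = List.length parts

  mult : ℕ → ℕ
  mult i = List.length (List.filter (ℕ._≟ i) parts)

  largest : ℕ
  largest = List.foldr ℕ._⊔_ 0 parts

  -- Zero-based, and padded by zeros: part i is λ_{i+1}.
  part : ℕ → ℕ
  part = go parts
    where
    go : List ℕ → ℕ → ℕ
    go []       _       = 0
    go (a ∷ as) zero    = a
    go (a ∷ as) (suc i) = go as i

open Partition public

ones : ℕ → Partition
ones n .parts      = List.replicate n 1
ones n .decreasing = go n
  where
  go : ∀ m → Linked ℕ._≥_ (List.replicate m 1)
  go 0             = []
  go 1             = [-]
  go (suc (suc m)) = ℕ.≤-refl ∷ go (suc m)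
ones n .positive   = All.replicate⁺ n (s≤s z≤n)

len-ones : ∀ n → len (ones n) ≡ n
len-ones zero    = refl
len-ones (suc n) = cong suc (len-ones n)

len-ones≤ : ∀ n → len (ones n) ℕ.≤ n
len-ones≤ n = ℕ.≤-reflexive (len-ones n)

-- (σ , ε) stands for the substitution x_i ↦ x_{σ i}^{±1}, the exponent
-- being -1 exactly when ε_i is true.
W : ℕ → Set
W n = Permutation′ n × Vec Bool n

-- Each permutation of suc n is `insert zero j π` for exactly one (j , π).
permutations : ∀ n → List (Permutation′ n)
permutations zero    = Perm.id ∷ []
permutations (suc n) =
  List.cartesianProductWith (Perm.insert Fin.zero) (List.allFin (suc n)) (permutations n)

signs : ∀ n → List (Vec Bool n)
signs zero    = Vec.[] ∷ []
signs (suc n) = List.cartesianProductWith Vec._∷_ (false ∷ true ∷ []) (signs n)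

elementsOfW : ∀ n → List (W n)
elementsOfW n = List.cartesianProduct (permutations n) (signs n)

-- The integers y with |y| ≤ N.
interval : ℕ → List ℤ
interval N = List.map +_ (List.upTo (suc N)) ++ List.map -[1+_] (List.upTo N)

Even : Pred ℤ _
Even y = + 2 ∣ y

even? : Decidable Even
even? y = + 2 ∣? y

sublistsOfLength : ∀ {a} {A : Set a} → ℕ → List A → List (List A)
sublistsOfLength zero    _        = [] ∷ []
sublistsOfLength (suc r) []       = []
sublistsOfLength (suc r) (a ∷ as) =
  List.map (a ∷_) (sublistsOfLength r as) ++ sublistsOfLength (suc r) as

-- Rational functions are represented by their values: an identity of
-- rational functions is an identity at all points, over all fields, at
-- which the denominators do not vanish.  Taking K to be the field of
-- rational functions in the x_i and a square root of t, and the x_i, t to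
-- be these indeterminates, recovers the formal identity.

module HallLittlewood {c ℓ₁ ℓ₂} (K : HeytingField c ℓ₁ ℓ₂) where

  open HeytingField K renaming (sym to ≈-sym; trans to ≈-trans; refl to ≈-refl)
  open CommutativeRing (HeytingCommutativeRing.commutativeRing heytingCommutativeRing)
    using (ring; semiring; *-monoid)
  open import Algebra.Apartness.Properties.HeytingCommutativeRing heytingCommutativeRing
    using (x-0≈x; 1#0; x#0y#0→xy#0; #-congˡ; #-congʳ)
  open import Algebra.Properties.Ring ring using (x[y-z]≈xy-xz)
  open import Algebra.Definitions.RawSemiring (Semiring.rawSemiring semiring) using (_^_) public
  open import Algebra.Definitions.RawMonoid (Monoid.rawMonoid *-monoid)
    using () renaming (sum to ∏) public

  ∏< : ∀ {n} → (∀ (i j : Fin n) → i Fin.< j → Carrier) → Carrier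
  ∏< f = ∏ λ i → ∏ λ j → factor i j (i Fin.<? j)
    where
    factor : ∀ i j → Dec (i Fin.< j) → Carrier
    factor i j (yes i<j) = f i j i<j
    factor i j (no  _)   = 1#

  ∑ : ∀ {a} {A : Set a} → List A → (A → Carrier) → Carrier
  ∑ as f = List.foldr (λ a s → f a + s) 0# as

  -- S is the sum of f over all integers satisfying P, where f has finite
  -- support.
  IsSum : ∀ {p} {P : Pred ℤ p} → Decidable P → (ℤ → Carrier) → Carrier → Set _
  IsSum {P = P} P? f S = ∃ λ N →
    (∀ y → P y → N ℕ.< ∣ y ∣ → f y ≈ 0#) × (S ≈ ∑ (List.filter P? (interval N)) f)

  #⇒-#0 : ∀ {a b} → a # b → a - b # 0#
  #⇒-#0 a#b with #⇒invertible a#b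
  ... | u , ul , ur = invertible⇒# (u , ≈-trans (*-congˡ (x-0≈x _)) ul
                                      , ≈-trans (*-congʳ (x-0≈x _)) ur)

  -#0⇒# : ∀ {a b} → a - b # 0# → a # b
  -#0⇒# a-b#0 with #⇒invertible a-b#0
  ... | u , ul , ur = invertible⇒# (u , ≈-trans (*-congˡ (≈-sym (x-0≈x _))) ul
                                      , ≈-trans (*-congʳ (≈-sym (x-0≈x _))) ur)

  -- #⇒invertible b#0 inverts b - 0#, which is ≈ b.
  infixl 7 _÷_[_]
  _÷_[_] : Carrier → (b : Carrier) → b # 0# → Carrier
  a ÷ b [ b#0 ] = a * proj₁ (#⇒invertible b#0)

  ^-#0 : ∀ {a} → a # 0# → ∀ m → a ^ m # 0#
  ^-#0 a#0 zero    = 1#0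
  ^-#0 a#0 (suc m) = x#0y#0→xy#0 a#0 (^-#0 a#0 m)

  *-#ˡ : ∀ {z a b} → z # 0# → a # b → z * a # z * b
  *-#ˡ z#0 a#b = -#0⇒# (#-congʳ (x[y-z]≈xy-xz _ _ _) (x#0y#0→xy#0 z#0 (#⇒-#0 a#b)))

  -- The denominators in x do not vanish; these conditions are W-stable.
  record GenericPoint (n : ℕ) : Set (c ⊔ ℓ₂) where
    field
      x     : Fin n → Carrier
      x#0   : ∀ i → x i # 0#
      1#x²  : ∀ i → 1# # x i * x i
      x#x   : ∀ {i j} → i ≢ j → x i # x j
      1#x*x : ∀ {i j} → i ≢ j → 1# # x i * x j

    x⁻¹ : Fin n → Carrier
    x⁻¹ i = 1# ÷ x i [ x#0 i ]

    x^± : Fin n → Bool → Carrier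
    x^± i ε = if ε then x⁻¹ i else x i

  open GenericPoint public

  module _ {u u′ v : Carrier} (u′u≈1 : u′ * u ≈ 1#) (u′#0 : u′ # 0#) where

    u′[uv]≈v : u′ * (u * v) ≈ v
    u′[uv]≈v = ≈-trans (≈-sym (*-assoc _ _ _)) (≈-trans (*-congʳ u′u≈1) (*-identityˡ _))

    flip-# : 1# # u * v → u′ # v
    flip-# p = #-congˡ u′[uv]≈v (#-congʳ (*-identityʳ _) (*-#ˡ u′#0 p))

    flip-1# : u # v → 1# # u′ * v
    flip-1# p = #-congʳ u′u≈1 (*-#ˡ u′#0 p)

  module _ {n} (p : GenericPoint n) where

    x⁻¹x≈1 : ∀ i → x⁻¹ p i * x p i ≈ 1#
    x⁻¹x≈1 i = ≈-trans (*-congʳ (*-identityˡ _))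
      (≈-trans (*-congˡ (≈-sym (x-0≈x _))) (proj₁ (proj₂ (#⇒invertible (x#0 p i)))))

    x⁻¹#0 : ∀ i → x⁻¹ p i # 0#
    x⁻¹#0 i = invertible⇒# (x p i
      , ≈-trans (*-congˡ (x-0≈x _)) (≈-trans (*-comm _ _) (x⁻¹x≈1 i))
      , ≈-trans (*-congʳ (x-0≈x _)) (x⁻¹x≈1 i))

    ±#0 : ∀ i ε → x^± p i ε # 0#
    ±#0 i false = x#0 p i
    ±#0 i true  = x⁻¹#0 i

    1#±² : ∀ i ε → 1# # x^± p i ε * x^± p i ε
    1#±² i false = 1#x² p i
    1#±² i true  = flip-1# (x⁻¹x≈1 i) (x⁻¹#0 i)
      (#-sym (flip-# (x⁻¹x≈1 i) (x⁻¹#0 i) (1#x² p i)))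

    ±#x : ∀ {i j} → i ≢ j → ∀ ε → x^± p i ε # x p j
    ±#x i≢j false = x#x p i≢j
    ±#x i≢j true  = flip-# (x⁻¹x≈1 _) (x⁻¹#0 _) (1#x*x p i≢j)

    1#±*x : ∀ {i j} → i ≢ j → ∀ ε → 1# # x^± p i ε * x p j
    1#±*x i≢j false = 1#x*x p i≢j
    1#±*x i≢j true  = flip-1# (x⁻¹x≈1 _) (x⁻¹#0 _) (x#x p i≢j)

    ±#± : ∀ {i j} → i ≢ j → ∀ ε δ → x^± p i ε # x^± p j δ
    ±#± i≢j ε false = ±#x i≢j ε
    ±#± i≢j ε true  =
      #-sym (flip-# (x⁻¹x≈1 _) (x⁻¹#0 _) (#-congˡ (*-comm _ _) (1#±*x i≢j ε)))

    1#±*± : ∀ {i j} → i ≢ j → ∀ ε δ → 1# # x^± p i ε * x^± p j δ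
    1#±*± i≢j ε false = 1#±*x i≢j ε
    1#±*± i≢j ε true  =
      #-congˡ (*-comm _ _) (flip-1# (x⁻¹x≈1 _) (x⁻¹#0 _) (#-sym (±#x i≢j ε)))

  act : ∀ {n} → W n → GenericPoint n → GenericPoint n
  act (σ , ε) p = record
    { x     = λ i → x^± p (σ ⟨$⟩ʳ i) (Vec.lookup ε i)
    ; x#0   = λ i → ±#0 p _ (Vec.lookup ε i)
    ; 1#x²  = λ i → 1#±² p _ (Vec.lookup ε i)
    ; x#x   = λ {i} {j} i≢j → ±#± p (i≢j ∘ inj) (Vec.lookup ε i) (Vec.lookup ε j)
    ; 1#x*x = λ {i} {j} i≢j → 1#±*± p (i≢j ∘ inj) (Vec.lookup ε i) (Vec.lookup ε j)
    }
    where
    inj : ∀ {i j} → σ ⟨$⟩ʳ i ≡ σ ⟨$⟩ʳ j → i ≡ j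
    inj {i} {j} eq = subst (_≡ j) (Perm.inverseˡ σ)
      (subst (λ k → σ Perm.⟨$⟩ˡ k ≡ j) (sym eq) (Perm.inverseˡ σ))

  infixr 8 _·_
  _·_ : ∀ {n} → W n → (GenericPoint n → Carrier) → GenericPoint n → Carrier
  (w · f) p = f (act w p)

  -- The empty sum, hence 0#, when r exceeds the number of variables.
  e : ℕ → List Carrier → Carrier
  e r as = ∑ (sublistsOfLength r as) (List.foldr _*_ 1#)

  ė : ∀ {n} → ℤ → GenericPoint n → Carrier
  ė {n} (+ r)    p = e r (List.concatMap (λ i → x p i ∷ x⁻¹ p i ∷ []) (List.allFin n))
  ė     -[1+ _ ] _ = 0#

  poch : Carrier → Carrier → ℕ → Carrier
  poch a t m = ∏ {m} λ i → 1# - a * t ^ toℕ i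

  v : ℕ → Partition → (t : Carrier) → 1# # t → Carrier
  v n μ t 1#t = ratio (n ℕ.∸ len μ) * ∏ {largest μ} λ i → ratio (mult μ (suc (toℕ i)))
    where
    ratio : ℕ → Carrier
    ratio m = poch t t m ÷ (1# - t) ^ m [ ^-#0 (#⇒-#0 1#t) m ]

  normaliserBC : ℕ → Partition → (t : Carrier) → 1# # t → (s₁ s₂ : Carrier) → Carrier
  normaliserBC n μ t 1#t s₁ s₂ = poch (s₁ * s₂) t (n ℕ.∸ len μ) * v n μ t 1#t

  summandBC : ∀ {n} → Partition → (t s₁ s₂ : Carrier) → GenericPoint n → Carrier
  summandBC μ t s₁ s₂ p =
      (∏ λ i → x⁻¹ p i ^ part μ (toℕ i)
             * ((1# - s₁ * x p i) * (1# - s₂ * x p i)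
                 ÷ (1# - x p i * x p i) [ #⇒-#0 (1#x² p i) ]))
    * (∏< λ i j i<j →
         let i≢j = Fin.<⇒≢ i<j in
         (t * x p i - x p j) * (1# - t * (x p i * x p j))
           ÷ (x p i - x p j) * (1# - x p i * x p j)
             [ x#0y#0→xy#0 (#⇒-#0 (x#x p i≢j)) (#⇒-#0 (1#x*x p i≢j)) ])

  PBC : ∀ {n} (μ : Partition) → len μ ℕ.≤ n →
        (t : Carrier) (1#t : 1# # t) (s₁ s₂ : Carrier) →
        normaliserBC n μ t 1#t s₁ s₂ # 0# →
        GenericPoint n → Carrier
  PBC {n} μ _ t 1#t s₁ s₂ nz p =
    ∑ (elementsOfW n) (λ w → (w · summandBC μ t s₁ s₂) p)
      ÷ normaliserBC n μ t 1#t s₁ s₂ [ nz ]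

  -- √s is any chosen square root of s in K.
  PC : ∀ {n} (μ : Partition) → len μ ℕ.≤ n →
       (t : Carrier) (1#t : 1# # t) (s √s : Carrier) → √s * √s ≈ s →
       normaliserBC n μ t 1#t √s (- √s) # 0# →
       GenericPoint n → Carrier
  PC μ len≤n t 1#t s √s _ nz = PBC μ len≤n t 1#t √s (- √s) nz

-- Both sides are polynomials in zᵢ = xᵢ + xᵢ⁻¹.  Sorting the Weyl group by
-- the image of the first coordinate writes the sum F over W in n variables as
-- Σⱼ Bⱼ F(x without xⱼ), where Bⱼ ∏ₖ (zₖ - zⱼ) (k ≠ j) is the value at ζ = - zⱼ
-- of an explicit polynomial H(ζ) of degree < n.  Hence, by Lagrange interpolation,
-- Σⱼ Bⱼ ∏ₖ (ζ + zₖ) (k ≠ j) = H(ζ).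
-- The right-hand sides of the theorem are L(∏ᵢ (ζ + zᵢ)), where ζ = u + u⁻¹ and L is
-- the linear functional on Laurent polynomials in u given by the theta series
-- Σ (-1)ᵖ tᵖ⁽ᵖ⁻¹⁾ᐟ² u²ᵖ for s = 0 and Σ (-1)ᵖ tᵖ⁽ᵖ⁻¹⁾ u²ᵖ for s = t.  Its
-- quasi-periodicity under u ↦ tu gives (1 - t) L(H) = (1 - tⁿ) L(∏ᵢ (ζ + zᵢ)), and
-- the theorem follows by induction on n.

module Submission where

open import Defs
open import Algebra.Apartness.Bundles using (HeytingCommutativeRing; HeytingField)
open import Algebra.Bundles using (CommutativeRing; RawRing; Semiring)
open import Data.Bool.Base using (Bool; true; false; not; if_then_else_)
open import Data.Fin.Base as Fin using (Fin; zero; suc; punchIn; toℕ)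
import Data.Fin.Properties as Fin
open import Data.Fin.Permutation as Perm using (Permutation′; _⟨$⟩ʳ_)
open import Data.Integer.Base as ℤ using (ℤ; +_; -[1+_]; ∣_∣)
import Data.Integer.Divisibility.Signed as ℤ
import Data.Integer.Properties as ℤ
open import Data.List.Base as List using (List; []; _∷_; _++_)
open import Data.Maybe.Base using (Maybe; just; nothing)
open import Data.Nat.Base as ℕ using (ℕ; zero; suc; _≥_; s≤s; s<s; z<s)
import Data.Nat.Divisibility as ℕ
import Data.Nat.Properties as ℕ
open import Data.Nat.Solver using (module +-*-Solver)
open import Data.Product.Base using (_×_; _,_; proj₁; proj₂)
open import Data.Unit.Base using (⊤; tt)
open import Data.Vec.Base as Vec using (Vec; []; _∷_; _∷ʳ_)
open import Function.Base using (_∘_; id)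
open import Level using (_⊔_)
open import Relation.Binary.PropositionalEquality.Core as ≡ using (_≡_; _≢_)
open import Relation.Nullary using (yes; no; does; ¬_; contradiction)
open import Relation.Nullary.Decidable using (dec-true; dec-false)
open import Relation.Unary using (Pred; Decidable)
open import Relation.Unary.Properties using (U?)

open +-*-Solver using () renaming (solve to ℕ-solve; _:+_ to _⊞_; _:*_ to _⊠_; con to #_; _:=_ to _≣_)

-- Where H and L come from. Write E(u) = ∏ᵢ (ζ + zᵢ). Once zₖ - zⱼ is cleared, the first variable a
-- = xⱼ or a = xⱼ⁻¹ of a term meets every other variable only in t zₖ - t² a - a⁻¹ = t (zₖ + t u +
-- (t u)⁻¹) with u = - a, so E(t u) enters. The two choices of a are joined by one Laurent
-- polynomial X = H + u G, with H and G polynomials in ζ, taking the required values at u = - a for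
-- both; the denominators 1 - a² are exactly what eliminates G. For s = t it is given by (1 - t) X =
-- E(u) - tⁿ E(t u). The functional L has to kill u G, which makes it odd under i ↦ 2 - i, and has
-- to turn E(t u) back into E(u); for s = t these two demands determine the theta series up to a
-- factor. Neither 2 nor t need be invertible in K. Hence negative powers of t are cleared, the
-- quotients by 1 - t and 1 - t u² are replaced by recursions, and facts that a reflection yields
-- only after doubling are carried through the inductions separately.

module IntegerSolver {c ℓ} (R : CommutativeRing c ℓ) where

  open CommutativeRing R
  open import Algebra.Solver.Ring.AlmostCommutativeRing
  open import Algebra.Properties.Semiring.Mult semiring
    using (×-homo-+; ×1-homo-*) renaming (_×_ to _⋆_)
  open import Algebra.Properties.AbelianGroup +-abelianGroup using (⁻¹-∙-comm; ⁻¹-involutive; ⁻¹-anti-homo‿-)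
    renaming (x≈y⇒x∙y⁻¹≈ε to x≈y⇒x-y≈0; x∙y⁻¹≈ε⇒x≈y to x-y≈0⇒x≈y)
  open import Algebra.Properties.CommutativeSemigroup +-commutativeSemigroup using (interchange)
  open import Algebra.Properties.Ring ring using (-‿distribˡ-*; -‿distribʳ-*; -0#≈0#)
  open import Relation.Binary.Reasoning.Setoid setoid

  -- (a , b) stands for the integer a − b: the solver needs no ring laws for
  -- its coefficients, only the operations.
  differences : RawRing _ _
  differences = record
    { Carrier = ℕ × ℕ
    ; _≈_     = λ (a , b) (c , d) → a ℕ.+ d ≡ b ℕ.+ c
    ; _+_     = λ (a , b) (c , d) → a ℕ.+ c , b ℕ.+ d
    ; _*_     = λ (a , b) (c , d) → a ℕ.* c ℕ.+ b ℕ.* d , a ℕ.* d ℕ.+ b ℕ.* c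
    ; -_      = λ (a , b) → b , a
    ; 0#      = 0 , 0
    ; 1#      = 1 , 0
    }

  difference : ℕ × ℕ → Carrier
  difference (a , b) = a ⋆ 1# - b ⋆ 1#

  -- The first two clauses make the constants :0 and :1 denote 0# and 1# definitionally.
  value : ℕ × ℕ → Carrier
  value (0 , 0) = 0#
  value (1 , 0) = 1#
  value p       = difference p

  value≈ : ∀ p → value p ≈ difference p
  value≈ (0 , 0)           = sym (-‿inverseʳ 0#)
  value≈ (1 , 0)           = sym (trans (+-cong (+-identityʳ 1#) -0#≈0#) (+-identityʳ 1#))
  value≈ (0 , suc _)       = refl
  value≈ (1 , suc _)       = refl
  value≈ (suc (suc _) , _) = refl

  [a+b]-[c+d] : ∀ a b c d → (a + b) - (c + d) ≈ (a - c) + (b - d)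
  [a+b]-[c+d] a b c d = trans (+-congˡ (sym (⁻¹-∙-comm c d))) (interchange a b (- c) (- d))

  [a-b][c-d] : ∀ a b c d → (a * c + b * d) - (a * d + b * c) ≈ (a - b) * (c - d)
  [a-b][c-d] a b c d = begin
    (a * c + b * d) - (a * d + b * c)      ≈⟨ [a+b]-[c+d] _ _ _ _ ⟩
    (a * c - a * d) + (b * d - b * c)      ≈⟨ +-cong (+-congˡ (-‿distribʳ-* a d)) (+-comm _ _) ⟩
    (a * c + a * - d) + (- (b * c) + b * d)
      ≈⟨ +-cong (sym (distribˡ a c (- d))) (+-cong (-‿distribˡ-* b c) b*d≈-b*-d) ⟩
    a * (c - d) + (- b * c + - b * - d)    ≈⟨ +-congˡ (sym (distribˡ (- b) c (- d))) ⟩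
    a * (c - d) + - b * (c - d)            ≈⟨ sym (distribʳ (c - d) a (- b)) ⟩
    (a - b) * (c - d)                      ∎
    where
    b*d≈-b*-d : b * d ≈ - b * - d
    b*d≈-b*-d = begin
      b * d          ≈⟨ sym (⁻¹-involutive _) ⟩
      - - (b * d)    ≈⟨ -‿cong (-‿distribʳ-* b d) ⟩
      - (b * - d)    ≈⟨ -‿distribˡ-* b (- d) ⟩
      - b * - d      ∎

  homomorphism : differences -Raw-AlmostCommutative⟶ fromCommutativeRing R
  homomorphism = record
    { ⟦_⟧    = value
    ; +-homo = λ p q → trans (value≈ (p +ᶜ q)) (trans (difference-+ p q) (sym (+-cong (value≈ p) (value≈ q))))
    ; *-homo = λ p q → trans (value≈ (p *ᶜ q)) (trans (difference-* p q) (sym (*-cong (value≈ p) (value≈ q))))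
    ; -‿homo = λ p → trans (value≈ (-ᶜ p)) (trans (sym (⁻¹-anti-homo‿- _ _)) (-‿cong (sym (value≈ p))))
    ; 0-homo = refl
    ; 1-homo = refl
    }
    where
    open RawRing differences using () renaming (_+_ to _+ᶜ_; _*_ to _*ᶜ_; -_ to -ᶜ_)

    difference-+ : ∀ p q → difference (p +ᶜ q) ≈ difference p + difference q
    difference-+ (a , b) (c , d) = trans
      (+-cong (×-homo-+ 1# a c) (-‿cong (×-homo-+ 1# b d)))
      ([a+b]-[c+d] _ _ _ _)

    difference-* : ∀ p q → difference (p *ᶜ q) ≈ difference p * difference q
    difference-* (a , b) (c , d) = trans
      (+-cong (trans (×-homo-+ 1# (a ℕ.* c) (b ℕ.* d)) (+-cong (×1-homo-* a c) (×1-homo-* b d)))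
        (-‿cong (trans (×-homo-+ 1# (a ℕ.* d) (b ℕ.* c)) (+-cong (×1-homo-* a d) (×1-homo-* b c)))))
      ([a-b][c-d] _ _ _ _)

  value≟ : ∀ p q → Maybe (value p ≈ value q)
  value≟ p@(a , b) q@(c , d) with a ℕ.+ d ℕ.≟ b ℕ.+ c
  ... | no _   = nothing
  ... | yes eq = just (trans (value≈ p) (trans (x-y≈0⇒x≈y _ _ (begin
    (A - B) - (C - D)      ≈⟨ [a+b]-[c+d] A (- B) C (- D) ⟩
    (A - C) + (- B - - D)  ≈⟨ +-congˡ (trans (+-congˡ (⁻¹-involutive D)) (+-comm (- B) D)) ⟩
    (A - C) + (D - B)      ≈⟨ sym ([a+b]-[c+d] A D C B) ⟩
    (A + D) - (C + B)      ≈⟨ x≈y⇒x-y≈0 (trans (sym (×-homo-+ 1# a d)) (trans (reflexive (≡.cong (_⋆ 1#) eq))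
                                (trans (×-homo-+ 1# b c) (+-comm B C)))) ⟩
    0#                     ∎)) (sym (value≈ q))))
    where
    A = a ⋆ 1#
    B = b ⋆ 1#
    C = c ⋆ 1#
    D = d ⋆ 1#

  open import Algebra.Solver.Ring differences (fromCommutativeRing R) homomorphism value≟ public

  :0 :1 : ∀ {n} → Polynomial n
  :0 = con (0 , 0)
  :1 = con (1 , 0)

  -- Certificates of ideal membership: L - R is written as a combination of differences l - r of
  -- known equations, and `solve` checks this polynomial identity. In this way relations such as a
  -- a⁻¹ = 1 enter the computations.
  combine₁ : ∀ {L R l₁ r₁} q₁ → l₁ ≈ r₁ → L - R ≈ q₁ * (l₁ - r₁) → L ≈ R
  combine₁ q₁ e₁ eq = x-y≈0⇒x≈y _ _ (trans eq (trans (*-congˡ (x≈y⇒x-y≈0 e₁)) (zeroʳ q₁)))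

  combine₂ : ∀ {L R l₁ r₁ l₂ r₂} q₁ q₂ → l₁ ≈ r₁ → l₂ ≈ r₂ →
             L - R ≈ q₁ * (l₁ - r₁) + q₂ * (l₂ - r₂) → L ≈ R
  combine₂ q₁ q₂ e₁ e₂ eq = combine₁ q₁ e₁
    (trans eq (trans (+-congˡ (trans (*-congˡ (x≈y⇒x-y≈0 e₂)) (zeroʳ q₂))) (+-identityʳ _)))

  combine₃ : ∀ {L R l₁ r₁ l₂ r₂ l₃ r₃} q₁ q₂ q₃ → l₁ ≈ r₁ → l₂ ≈ r₂ → l₃ ≈ r₃ →
             L - R ≈ q₁ * (l₁ - r₁) + q₂ * (l₂ - r₂) + q₃ * (l₃ - r₃) → L ≈ R
  combine₃ q₁ q₂ q₃ e₁ e₂ e₃ eq = combine₂ q₁ q₂ e₁ e₂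
    (trans eq (trans (+-congˡ (trans (*-congˡ (x≈y⇒x-y≈0 e₃)) (zeroʳ q₃))) (+-identityʳ _)))

-- Polynomials in ζ acting through a linear operator; Lagrange interpolation

module Polynomials {c ℓ} (R : CommutativeRing c ℓ) where

  open CommutativeRing R hiding (zero)
  open import Algebra.Definitions.RawMonoid +-rawMonoid public using (sum)
  open import Algebra.Definitions.RawMonoid *-rawMonoid public using () renaming (sum to product)
  open import Algebra.Properties.CommutativeMonoid.Sum +-commutativeMonoid using (sum-cong-≋)
  open import Relation.Binary.Reasoning.Setoid setoid
  open IntegerSolver R using (solve; _:+_; _:*_; _:-_; :-_; _:=_; :0; :1)

  record LinearOperator (I : Set) : Set (c ⊔ ℓ) where
    field
      op      : (I → Carrier) → I → Carrier
      op-cong : ∀ {f g} → (∀ i → f i ≈ g i) → ∀ i → op f i ≈ op g i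
      op-+    : ∀ f g i → op (λ i → f i + g i) i ≈ op f i + op g i
      op-*    : ∀ k f i → op (λ i → k * f i) i ≈ k * op f i

    op-0 : ∀ i → op (λ _ → 0#) i ≈ 0#
    op-0 i = trans (op-cong (λ _ → sym (zeroˡ 0#)) i) (trans (op-* 0# (λ _ → 0#) i) (zeroˡ _))

  open LinearOperator public

  Poly : ℕ → Set c
  Poly = Vec Carrier

  infixl 6 _⊕_
  infixr 7 _⊙_

  _⊕_ : ∀ {n} → Poly n → Poly n → Poly n
  _⊕_ = Vec.zipWith _+_

  _⊙_ : ∀ {n} → Carrier → Poly n → Poly n
  k ⊙ p = Vec.map (k *_) p

  pad : ∀ {n} → Poly n → Poly (suc n)
  pad p = p ∷ʳ 0#

  -- Multiplication by the polynomial a + bζ.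
  affine : ∀ {n} → Carrier → Carrier → Poly n → Poly (suc n)
  affine a b p = pad (a ⊙ p) ⊕ (0# ∷ b ⊙ p)

  module _ {I : Set} (T : LinearOperator I) where

    apply : ∀ {n} → Poly n → (I → Carrier) → I → Carrier
    apply []      f i = 0#
    apply (a ∷ p) f i = a * f i + op T (apply p f) i

    apply-cong : ∀ {n} (p : Poly n) {f g} → (∀ i → f i ≈ g i) → ∀ i → apply p f i ≈ apply p g i
    apply-cong []      f≈g i = refl
    apply-cong (a ∷ p) f≈g i = +-cong (*-congˡ (f≈g i)) (op-cong T (apply-cong p f≈g) i)

    apply-⊕ : ∀ {n} (p q : Poly n) f i → apply (p ⊕ q) f i ≈ apply p f i + apply q f i
    apply-⊕ []      []      f i = sym (+-identityˡ 0#)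
    apply-⊕ (a ∷ p) (b ∷ q) f i = begin
      (a + b) * f i + op T (apply (p ⊕ q) f) i
        ≈⟨ +-congˡ (trans (op-cong T (apply-⊕ p q f) i) (op-+ T _ _ i)) ⟩
      (a + b) * f i + (op T (apply p f) i + op T (apply q f) i)
        ≈⟨ solve 5 (λ a b x y z → (a :+ b) :* x :+ (y :+ z) := (a :* x :+ y) :+ (b :* x :+ z))
             refl a b (f i) _ _ ⟩
      apply (a ∷ p) f i + apply (b ∷ q) f i ∎

    apply-⊙ : ∀ {n} k (p : Poly n) f i → apply (k ⊙ p) f i ≈ k * apply p f i
    apply-⊙ k []      f i = sym (zeroʳ k)
    apply-⊙ k (a ∷ p) f i = begin
      k * a * f i + op T (apply (k ⊙ p) f) i
        ≈⟨ +-congˡ (trans (op-cong T (apply-⊙ k p f) i) (op-* T k _ i)) ⟩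
      k * a * f i + k * op T (apply p f) i
        ≈⟨ solve 4 (λ k a x y → k :* a :* x :+ k :* y := k :* (a :* x :+ y)) refl k a (f i) _ ⟩
      k * apply (a ∷ p) f i ∎

    apply-pad : ∀ {n} (p : Poly n) f i → apply (pad p) f i ≈ apply p f i
    apply-pad []      f i = trans (+-cong (zeroˡ _) (op-0 T i)) (+-identityˡ 0#)
    apply-pad (a ∷ p) f i = +-congˡ (op-cong T (apply-pad p f) i)

    apply-affine : ∀ {n} a b (p : Poly n) f i →
                   apply (affine a b p) f i ≈ a * apply p f i + b * op T (apply p f) i
    apply-affine a b p f i = begin
      apply (affine a b p) f i
        ≈⟨ apply-⊕ (pad (a ⊙ p)) (0# ∷ b ⊙ p) f i ⟩
      apply (pad (a ⊙ p)) f i + (0# * f i + op T (apply (b ⊙ p) f) i)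
        ≈⟨ +-cong (trans (apply-pad (a ⊙ p) f i) (apply-⊙ a p f i))
             (+-cong (zeroˡ _) (trans (op-cong T (apply-⊙ b p f) i) (op-* T b _ i))) ⟩
      a * apply p f i + (0# + b * op T (apply p f) i)
        ≈⟨ +-congˡ (+-identityˡ _) ⟩
      a * apply p f i + b * op T (apply p f) i ∎

    apply-linear : ∀ {n} (p : Poly n) a f i →
                   apply p (λ i → a * f i + op T f i) i ≈ a * apply p f i + op T (apply p f) i
    apply-linear []      a f i = sym (trans (+-cong (zeroʳ a) (op-0 T i)) (+-identityˡ 0#))
    apply-linear (b ∷ p) a f i = begin
      b * (a * f i + op T f i) + op T (apply p (λ i → a * f i + op T f i)) i
        ≈⟨ +-congˡ (trans (op-cong T (apply-linear p a f) i)
                   (trans (op-+ T _ _ i) (+-congʳ (op-* T a _ i)))) ⟩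
      b * (a * f i + op T f i) + (a * op T (apply p f) i + op T (op T (apply p f)) i)
        ≈⟨ solve 6 (λ b a x y z w → b :* (a :* x :+ y) :+ (a :* z :+ w)
                                 := a :* (b :* x :+ z) :+ (b :* y :+ w))
             refl b a (f i) _ _ _ ⟩
      a * (b * f i + op T (apply p f) i) + (b * op T f i + op T (op T (apply p f)) i)
        ≈⟨ +-congˡ (trans (+-congʳ (sym (op-* T b f i))) (sym (op-+ T _ _ i))) ⟩
      a * apply (b ∷ p) f i + op T (apply (b ∷ p) f) i ∎

  scalar : Carrier → LinearOperator ⊤
  scalar y = record
    { op      = λ f _ → y * f tt
    ; op-cong = λ f≈g _ → *-congˡ (f≈g tt)
    ; op-+    = λ _ _ _ → distribˡ y _ _
    ; op-*    = λ k f _ → solve 3 (λ y k x → y :* (k :* x) := k :* (y :* x)) refl y k (f tt)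
    }

  -- Evaluation is p(T) for T the multiplication by y on a module of rank one, so the lemmas on
  -- `apply` cover values and functionals alike.
  eval : ∀ {n} → Poly n → Carrier → Carrier
  eval p y = apply (scalar y) p (λ _ → 1#) tt

  eval-cong : ∀ {n} (p : Poly n) {y y′} → y ≈ y′ → eval p y ≈ eval p y′
  eval-cong []      y≈y′ = refl
  eval-cong (a ∷ p) y≈y′ = +-congˡ (*-cong y≈y′ (eval-cong p y≈y′))

  -- Synthetic division by ζ - y: the coefficients of the quotient are the values at y of the
  -- successive tails of the polynomial.
  quotient : ∀ {n} → Poly (suc n) → Carrier → Poly n
  quotient (a ∷ [])    y = []
  quotient (a ∷ b ∷ p) y = eval (b ∷ p) y ∷ quotient (b ∷ p) y

  apply-quotient : ∀ {I} (T : LinearOperator I) {n} (p : Poly (suc n)) y f i →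
    apply T p f i ≈ eval p y * f i + (- y * apply T (quotient p y) f i + op T (apply T (quotient p y) f) i)
  apply-quotient T (a ∷ []) y f i = begin
    a * f i + op T (λ _ → 0#) i
      ≈⟨ solve 4 (λ a x y z → a :* x :+ z := (a :* :1 :+ y :* :0) :* x :+ (:- y :* :0 :+ z))
           refl a (f i) y _ ⟩
    (a * 1# + y * 0#) * f i + (- y * 0# + op T (λ _ → 0#) i) ∎
  apply-quotient T (a ∷ b ∷ p) y f i = begin
    a * f i + op T (apply T (b ∷ p) f) i
      ≈⟨ +-congˡ (trans (op-cong T (apply-quotient T (b ∷ p) y f) i)
           (trans (op-+ T _ _ i) (+-cong (op-* T r f i)
             (trans (op-+ T _ _ i) (+-congʳ (op-* T (- y) q i)))))) ⟩
    a * f i + (r * op T f i + (- y * op T q i + op T (op T q) i))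
      ≈⟨ solve 7 (λ a x r y Tf Tq TTq →
             a :* x :+ (r :* Tf :+ (:- y :* Tq :+ TTq))
          := (a :* :1 :+ y :* r) :* x :+ (:- y :* (r :* x :+ Tq) :+ (r :* Tf :+ TTq)))
           refl a (f i) r y _ _ _ ⟩
    (a * 1# + y * r) * f i + (- y * (r * f i + op T q i) + (r * op T f i + op T (op T q) i))
      ≈⟨ +-congˡ (+-congˡ (trans (+-congʳ (sym (op-* T r f i))) (sym (op-+ T _ _ i)))) ⟩
    (a * 1# + y * r) * f i + (- y * (r * f i + op T q i) + op T (λ i → r * f i + op T q i) i) ∎
    where
    r = eval (b ∷ p) y
    q = apply T (quotient (b ∷ p) y) f

  -- ∏ᵢ (ζ + zᵢ)
  E : ∀ {n} → (Fin n → Carrier) → Poly (suc n)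
  E {zero}  z = 1# ∷ []
  E {suc n} z = affine (z zero) 1# (E (z ∘ suc))

  module _ {I : Set} (T : LinearOperator I) where

    apply-1 : ∀ (z : Fin 0 → Carrier) f i → apply T (E z) f i ≈ f i
    apply-1 z f i = trans (+-cong (*-identityˡ _) (op-0 T i)) (+-identityʳ _)

    apply-E : ∀ {n} (z : Fin (suc n) → Carrier) f i →
      apply T (E z) f i ≈ z zero * apply T (E (z ∘ suc)) f i + op T (apply T (E (z ∘ suc)) f) i
    apply-E z f i = trans (apply-affine T (z zero) 1# (E (z ∘ suc)) f i) (+-congˡ (*-identityˡ _))

    apply-E-cong : ∀ {n} {z z′ : Fin n → Carrier} → (∀ i → z i ≈ z′ i) →
                   ∀ f i → apply T (E z) f i ≈ apply T (E z′) f i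
    apply-E-cong {zero}  z≈z′ f i = refl
    apply-E-cong {suc n} {z} {z′} z≈z′ f i = begin
      apply T (E z) f i ≈⟨ apply-E z f i ⟩
      z zero * apply T (E (z ∘ suc)) f i + op T (apply T (E (z ∘ suc)) f) i
        ≈⟨ +-cong (*-cong (z≈z′ zero) (apply-E-cong (z≈z′ ∘ suc) f i))
             (op-cong T (apply-E-cong (z≈z′ ∘ suc) f) i) ⟩
      z′ zero * apply T (E (z′ ∘ suc)) f i + op T (apply T (E (z′ ∘ suc)) f) i
        ≈⟨ sym (apply-E z′ f i) ⟩
      apply T (E z′) f i ∎

  eval-E : ∀ {n} (z : Fin n → Carrier) y → eval (E z) y ≈ product (λ k → z k + y)
  eval-E {zero}  z y = apply-1 (scalar y) z (λ _ → 1#) tt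
  eval-E {suc n} z y = begin
    eval (E z) y                     ≈⟨ apply-E (scalar y) z (λ _ → 1#) tt ⟩
    z zero * eval (E (z ∘ suc)) y + y * eval (E (z ∘ suc)) y ≈⟨ sym (distribʳ _ _ _) ⟩
    (z zero + y) * eval (E (z ∘ suc)) y ≈⟨ *-congˡ (eval-E (z ∘ suc) y) ⟩
    product (λ k → z k + y) ∎

  eval-E-root : ∀ {n} (z : Fin n → Carrier) {y} j → z j + y ≈ 0# → eval (E z) y ≈ 0#
  eval-E-root z {y} j zⱼ+y≈0 = trans (eval-E z y) (vanish z j zⱼ+y≈0)
    where
    vanish : ∀ {n} (z : Fin n → Carrier) j → z j + y ≈ 0# → product (λ k → z k + y) ≈ 0#
    vanish z zero    root = trans (*-congʳ root) (zeroˡ _)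
    vanish z (suc j) root = trans (*-congˡ (vanish (z ∘ suc) j root)) (zeroʳ _)

  -- Lagrange interpolation at the nodes ζ = - zⱼ.  Subtracting the term of z₀
  -- leaves a multiple of ζ + z₀, and the quotient is interpolated by the
  -- remaining terms.
  interpolation : ∀ {I} (T : LinearOperator I) {n} (z : Fin (suc n) → Carrier) →
    (∀ {i j} → i ≢ j → ∀ {a b} → (z i - z j) * a ≈ (z i - z j) * b → a ≈ b) →
    (B : Fin (suc n) → Carrier) (p : Poly (suc n)) →
    (∀ j → eval p (- z j) ≈ B j * product (λ k → z (punchIn j k) - z j)) →
    ∀ f i → apply T p f i ≈ sum (λ j → B j * apply T (E (z ∘ punchIn j)) f i)
  interpolation T {n} z cancel B p values f i = begin
    apply T p f i
      ≈⟨ solve 3 (λ p b e → p := b :* e :+ (p :+ :- b :* e)) refl (apply T p f i) (B zero) _ ⟩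
    B zero * apply T E₀ f i + (apply T p f i + - B zero * apply T E₀ f i)
      ≈⟨ +-congˡ (sym (trans (apply-⊕ T p (- B zero ⊙ E₀) f i) (+-congˡ (apply-⊙ T (- B zero) E₀ f i)))) ⟩
    B zero * apply T E₀ f i + apply T p₀ f i
      ≈⟨ +-congˡ (trans (factor T f i) (trans (sym (apply-linear T q (z zero) f i)) (rest n z cancel B q qvalues))) ⟩
    sum (λ j → B j * apply T (E (z ∘ punchIn j)) f i) ∎
    where
    E₀ = E (z ∘ suc)
    p₀ = p ⊕ (- B zero ⊙ E₀)
    q = quotient p₀ (- z zero)

    eval-p₀ : ∀ y → eval p₀ y ≈ eval p y + - B zero * eval E₀ y
    eval-p₀ y = trans (apply-⊕ (scalar y) p (- B zero ⊙ E₀) _ tt)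
                      (+-congˡ (apply-⊙ (scalar y) (- B zero) E₀ _ tt))

    root : eval p₀ (- z zero) ≈ 0#
    root = trans (eval-p₀ (- z zero))
      (trans (+-cong (values zero) (*-congˡ (eval-E (z ∘ suc) (- z zero))))
        (solve 2 (λ b e → b :* e :+ :- b :* e := :0) refl _ _))

    factor : ∀ {I} (T : LinearOperator I) f i →
             apply T p₀ f i ≈ z zero * apply T q f i + op T (apply T q f) i
    factor T f i = begin
      apply T p₀ f i ≈⟨ apply-quotient T p₀ (- z zero) f i ⟩
      eval p₀ (- z zero) * f i + (- - z zero * apply T q f i + op T (apply T q f) i)
        ≈⟨ +-congʳ (trans (*-congʳ root) (zeroˡ _)) ⟩
      0# + (- - z zero * apply T q f i + op T (apply T q f) i)
        ≈⟨ solve 3 (λ z q Tq → :0 :+ (:- (:- z) :* q :+ Tq) := z :* q :+ Tq) refl _ _ _ ⟩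
      z zero * apply T q f i + op T (apply T q f) i ∎

    qvalues : ∀ j → (z zero - z (suc j)) * eval q (- z (suc j))
                      ≈ B (suc j) * product (λ k → z (punchIn (suc j) k) - z (suc j))
    qvalues j = begin
      (z zero - z (suc j)) * eval q (- z (suc j)) ≈⟨ distribʳ _ _ _ ⟩
      z zero * eval q (- z (suc j)) + - z (suc j) * eval q (- z (suc j))
        ≈⟨ sym (factor (scalar (- z (suc j))) (λ _ → 1#) tt) ⟩
      eval p₀ (- z (suc j)) ≈⟨ eval-p₀ (- z (suc j)) ⟩
      eval p (- z (suc j)) + - B zero * eval E₀ (- z (suc j))
        ≈⟨ +-cong (values (suc j)) (*-congˡ (eval-E-root (z ∘ suc) j (-‿inverseʳ _))) ⟩
      B (suc j) * product (λ k → z (punchIn (suc j) k) - z (suc j)) + - B zero * 0#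
        ≈⟨ trans (+-congˡ (zeroʳ _)) (+-identityʳ _) ⟩
      B (suc j) * product (λ k → z (punchIn (suc j) k) - z (suc j)) ∎

    rest : ∀ n (z : Fin (suc n) → Carrier) →
      (∀ {i j} → i ≢ j → ∀ {a b} → (z i - z j) * a ≈ (z i - z j) * b → a ≈ b) →
      (B : Fin (suc n) → Carrier) (q : Poly n) →
      (∀ j → (z zero - z (suc j)) * eval q (- z (suc j))
               ≈ B (suc j) * product (λ k → z (punchIn (suc j) k) - z (suc j))) →
      apply T q (λ i → z zero * f i + op T f i) i
        ≈ sum (λ j → B (suc j) * apply T (E (z ∘ punchIn (suc j))) f i)
    rest zero    z cancel B [] _  = refl
    rest (suc n) z cancel B q  qv = trans
      -- The factor z₀ + ζ that the division took away is restored by interpolating on (z₀ + T) f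
      -- instead of f; it completes each product over the remaining nodes.
      (interpolation T (z ∘ suc) (λ i≢j → cancel (i≢j ∘ Fin.suc-injective)) (B ∘ suc) q
        (λ j → cancel {zero} {suc j} (λ ()) (trans (qv j)
           (solve 3 (λ b w e → b :* (w :* e) := w :* (b :* e)) refl _ _ _)))
        (λ i → z zero * f i + op T f i) i)
      (sum-cong-≋ λ j → *-congˡ {B (suc j)} (trans
        (apply-linear T (E (z ∘ suc ∘ punchIn j)) (z zero) f i)
        (sym (apply-E T (z ∘ punchIn (suc j)) f i))))

-- The polynomial H

module Recursion {c ℓ} (R : CommutativeRing c ℓ) (t s : CommutativeRing.Carrier R) where

  open CommutativeRing R hiding (zero)
  open import Algebra.Definitions.RawSemiring (Semiring.rawSemiring semiring) using (_^_)
  open import Relation.Binary.Reasoning.Setoid setoid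
  open IntegerSolver R using (solve; _:+_; _:*_; _:-_; :-_; _:=_; :0; :1; combine₁; combine₂; combine₃)
  open Polynomials R

  -- Chosen so that `X-V` survives the recursion. For s = t it is 1 + t, the coefficient of u in
  -- ((z₀ + ζ) - (t z₀ + t² u + u⁻¹)) / (1 - t); the term with tⁿ corrects for 1 - s a² differing
  -- from 1 - t a².
  κ : ℕ → Carrier
  κ n = 1# + t - (t - s) * t ^ n

  -- With u + u⁻¹ = ζ, the Laurent polynomial X = H + u G in u satisfies
  -- X (z₀ ∷ z) = (t z₀ + t² u + u⁻¹) X z + (z₀ + κ u) E z.
  H G : ∀ {n} → (Fin n → Carrier) → Poly n
  H {zero}  z = []
  H {suc n} z = affine (t * z zero) 1# (H (z ∘ suc))
              ⊕ (z zero ⊙ E (z ∘ suc) ⊕ pad ((1# - t * t) ⊙ G (z ∘ suc)))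
  G {zero}  z = []
  G {suc n} z = affine (t * z zero) (t * t) (G (z ∘ suc))
              ⊕ (κ n ⊙ E (z ∘ suc) ⊕ pad (- (1# - t * t) ⊙ H (z ∘ suc)))

  module _ {I : Set} (T : LinearOperator I) where

    apply-combination : ∀ {n} a b (p : Poly n) k (e : Poly (suc n)) l (q : Poly n) f i →
      apply T (affine a b p ⊕ (k ⊙ e ⊕ pad (l ⊙ q))) f i
        ≈ a * apply T p f i + b * op T (apply T p f) i + (k * apply T e f i + l * apply T q f i)
    apply-combination a b p k e l q f i = trans (apply-⊕ T (affine a b p) (k ⊙ e ⊕ pad (l ⊙ q)) f i)
      (+-cong (apply-affine T a b p f i) (trans (apply-⊕ T (k ⊙ e) (pad (l ⊙ q)) f i)
        (+-cong (apply-⊙ T k e f i) (trans (apply-pad T (l ⊙ q) f i) (apply-⊙ T l q f i)))))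

    apply-H : ∀ {n} (z : Fin (suc n) → Carrier) f i →
      apply T (H z) f i
        ≈ t * z zero * apply T (H (z ∘ suc)) f i + 1# * op T (apply T (H (z ∘ suc)) f) i
        + (z zero * apply T (E (z ∘ suc)) f i + (1# - t * t) * apply T (G (z ∘ suc)) f i)
    apply-H z = apply-combination _ _ (H (z ∘ suc)) _ (E (z ∘ suc)) _ (G (z ∘ suc))

    apply-G : ∀ {n} (z : Fin (suc n) → Carrier) f i →
      apply T (G z) f i
        ≈ t * z zero * apply T (G (z ∘ suc)) f i + t * t * op T (apply T (G (z ∘ suc)) f) i
        + (κ n * apply T (E (z ∘ suc)) f i + - (1# - t * t) * apply T (H (z ∘ suc)) f i)
    apply-G z = apply-combination _ _ (G (z ∘ suc)) _ (E (z ∘ suc)) _ (H (z ∘ suc))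

  module AtRoot {a ā : Carrier} (aā≈1 : a * ā ≈ 1#) where

    y : Carrier
    y = - (a + ā)

    -- The value at u = - a of the Laurent polynomial X.
    X : ∀ {n} → (Fin n → Carrier) → Carrier
    X z = eval (H z) y - a * eval (G z) y

    -- This is t times the factor z + ζ with t u in place of u, at u = - a. Hence the product `V` is
    -- tⁿ ∏ᵢ (ζ + zᵢ) after the substitution u ↦ t u.
    φ : Carrier → Carrier
    φ z = t * z - (t * t * a + ā)

    X-suc : ∀ {n} (z : Fin (suc n) → Carrier) →
            X z ≈ φ (z zero) * X (z ∘ suc) + (z zero - κ n * a) * eval (E (z ∘ suc)) y
    X-suc {n} z = trans
      (+-cong (apply-H (scalar y) z _ tt) (-‿cong (*-congˡ (apply-G (scalar y) z _ tt))))
      (combine₁ (- (1# - t * t) * g) aā≈1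
        (solve 8 (λ t z h g e κ a ā →
             (t :* z :* h :+ :1 :* (:- (a :+ ā) :* h) :+ (z :* e :+ (:1 :- t :* t) :* g)
              :- a :* (t :* z :* g :+ t :* t :* (:- (a :+ ā) :* g) :+ (κ :* e :+ :- (:1 :- t :* t) :* h)))
             :- ((t :* z :- (t :* t :* a :+ ā)) :* (h :- a :* g) :+ (z :- κ :* a) :* e)
          := :- (:1 :- t :* t) :* g :* (a :* ā :- :1))
         refl t (z zero) h g (eval (E (z ∘ suc)) y) (κ n) a ā))
      where
      h = eval (H (z ∘ suc)) y
      g = eval (G (z ∘ suc)) y

    V : ∀ {n} → (Fin n → Carrier) → Carrier
    V z = product (λ k → φ (z k))

    -- The closed form of X with its denominators 1 - t and 1 - t a² cleared. It is an invariant of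
    -- the recursion: modulo a ā = 1, adding a variable multiplies the difference of the two sides
    -- by φ z₀.
    X-V : ∀ {n} (z : Fin n → Carrier) →
      (1# - t * (a * a)) * (eval (E z) y - (1# - t) * X z) + (t - s) * (a * a) * (t ^ n * eval (E z) y)
        ≈ (1# - s * (a * a)) * V z
    X-V {zero} z = trans (+-cong (*-congˡ (+-congʳ e≈1)) (*-congˡ (*-congˡ e≈1)))
      (solve 3 (λ t s a →
           (:1 :- t :* (a :* a)) :* (:1 :- (:1 :- t) :* (:0 :- a :* :0)) :+ (t :- s) :* (a :* a) :* (:1 :* :1)
        := (:1 :- s :* (a :* a)) :* :1) refl t s a)
      where
      e≈1 : eval (E z) y ≈ 1#
      e≈1 = apply-1 (scalar y) z (λ _ → 1#) tt
    X-V {suc n} z = trans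
      (+-cong (*-congˡ (+-cong (apply-E (scalar y) z (λ _ → 1#) tt) (-‿cong (*-congˡ (X-suc z)))))
        (*-congˡ (*-congˡ (apply-E (scalar y) z (λ _ → 1#) tt))))
      (combine₂ (φ (z zero)) ((t - s) * t ^ n * (1# - t) * a * e)
        (X-V (z ∘ suc)) aā≈1
        (solve 9 (λ t s τ a ā z x e v →
             ((:1 :- t :* (a :* a)) :* ((z :* e :+ :- (a :+ ā) :* e)
                 :- (:1 :- t) :* ((t :* z :- (t :* t :* a :+ ā)) :* x :+ (z :- (:1 :+ t :- (t :- s) :* τ) :* a) :* e))
               :+ (t :- s) :* (a :* a) :* (t :* τ :* (z :* e :+ :- (a :+ ā) :* e)))
             :- (:1 :- s :* (a :* a)) :* ((t :* z :- (t :* t :* a :+ ā)) :* v)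
          := (t :* z :- (t :* t :* a :+ ā))
               :* ((:1 :- t :* (a :* a)) :* (e :- (:1 :- t) :* x) :+ (t :- s) :* (a :* a) :* (τ :* e)
                   :- (:1 :- s :* (a :* a)) :* v)
             :+ (t :- s) :* τ :* (:1 :- t) :* a :* e :* (a :* ā :- :1))
         refl t s (t ^ n) a ā (z zero) (X (z ∘ suc)) e (V (z ∘ suc))))
      where
      e = eval (E (z ∘ suc)) y

    -- If the root is the first variable, then φ (a + ā) = - (1 - t) ā (1 - t a²), which is ā times
    -- the coefficient of X in `X-V`; so `X-V` times ā gives the value, and the denominators of the
    -- closed form never have to be inverted. If the root comes later, it kills the E term and φ z₀
    -- joins the product.
    X-root : ∀ {n} (z : Fin (suc n) → Carrier) j → z j ≈ a + ā →
             X z ≈ ā * (1# - s * (a * a)) * V (z ∘ punchIn j)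
    X-root {n} z zero z₀≈a+ā = trans (X-suc z)
      (combine₃ ā (t * x + e) ((t * a - w * a) * e - t * (1# - t) * a * x) (X-V (z ∘ suc)) z₀≈a+ā aā≈1
        (solve 9 (λ t s τ a ā z x e v →
             ((t :* z :- (t :* t :* a :+ ā)) :* x :+ (z :- (:1 :+ t :- (t :- s) :* τ) :* a) :* e)
               :- ā :* (:1 :- s :* (a :* a)) :* v
          := ā :* ((:1 :- t :* (a :* a)) :* (e :- (:1 :- t) :* x) :+ (t :- s) :* (a :* a) :* (τ :* e)
                   :- (:1 :- s :* (a :* a)) :* v)
             :+ (t :* x :+ e) :* (z :- (a :+ ā))
             :+ ((t :* a :- (t :- s) :* τ :* a) :* e :- t :* (:1 :- t) :* a :* x) :* (a :* ā :- :1))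
         refl t s (t ^ n) a ā (z zero) x e (V (z ∘ suc))))
      where
      e = eval (E (z ∘ suc)) y
      x = X (z ∘ suc)
      w = (t - s) * t ^ n
    X-root {suc n} z (suc j) zⱼ≈a+ā = begin
      X z ≈⟨ X-suc z ⟩
      φ (z zero) * X (z ∘ suc) + (z zero - κ (suc n) * a) * eval (E (z ∘ suc)) y
        ≈⟨ +-cong (*-congˡ (X-root (z ∘ suc) j zⱼ≈a+ā))
             (*-congˡ (eval-E-root (z ∘ suc) j (trans (+-congʳ zⱼ≈a+ā) (-‿inverseʳ _)))) ⟩
      φ (z zero) * (ā * (1# - s * (a * a)) * V (z ∘ suc ∘ punchIn j)) + (z zero - κ (suc n) * a) * 0#
        ≈⟨ solve 4 (λ φ b v k → φ :* (b :* v) :+ k :* :0 := b :* (φ :* v)) refl _ _ _ _ ⟩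
      ā * (1# - s * (a * a)) * V (z ∘ punchIn (suc j)) ∎

  -- H is recovered from the values of H + u G at u = - a and at u = - a⁻¹.
  H-root : ∀ {n} (z : Fin (suc n) → Carrier) j {a ā w w̄} (aā≈1 : a * ā ≈ 1#) (āa≈1 : ā * a ≈ 1#) →
    w * (1# - a * a) ≈ 1# → w̄ * (1# - ā * ā) ≈ 1# → z j ≈ a + ā →
    eval (H z) (- (a + ā))
      ≈ w * (ā * (1# - s * (a * a)) * AtRoot.V aā≈1 (z ∘ punchIn j))
      + w̄ * (a * (1# - s * (ā * ā)) * AtRoot.V āa≈1 (z ∘ punchIn j))
  H-root z j {a} {ā} {w} {w̄} aā≈1 āa≈1 w≈ w̄≈ zⱼ≈a+ā = begin
    h ≈⟨ combine₃ (- (h - ā * g)) (- h) (- (a * w * g)) w̄≈-a²w w≈ aā≈1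
           (solve 6 (λ h g a ā w w̄ → h :- (w :* (h :- a :* g) :+ w̄ :* (h :- ā :* g))
              := (:- (h :- ā :* g)) :* (w̄ :- :- (a :* a :* w)) :+ (:- h) :* (w :* (:1 :- a :* a) :- :1)
                 :+ (:- (a :* w :* g)) :* (a :* ā :- :1))
             refl h g a ā w w̄) ⟩
    w * (h - a * g) + w̄ * (h - ā * g)
      ≈⟨ +-cong (*-congˡ (AtRoot.X-root aā≈1 z j zⱼ≈a+ā))
           (*-congˡ (trans (+-cong (eval-cong (H z) y≈) (-‿cong (*-congˡ (eval-cong (G z) y≈))))
              (AtRoot.X-root āa≈1 z j (trans zⱼ≈a+ā (+-comm a ā))))) ⟩
    _ ∎
    where
    h = eval (H z) (- (a + ā))
    g = eval (G z) (- (a + ā))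

    y≈ : - (a + ā) ≈ - (ā + a)
    y≈ = -‿cong (+-comm a ā)

    w̄≈-a²w : w̄ ≈ - (a * a * w)
    w̄≈-a²w = combine₃ (- w̄) (- (a * a * w)) (- (w * w̄ * (a * ā + 1#))) w≈ w̄≈ aā≈1
      (solve 4 (λ a ā w w̄ → w̄ :- :- (a :* a :* w)
         := (:- w̄) :* (w :* (:1 :- a :* a) :- :1) :+ (:- (a :* a :* w)) :* (w̄ :* (:1 :- ā :* ā) :- :1)
            :+ (:- (w :* w̄ :* (a :* ā :+ :1))) :* (a :* ā :- :1))
        refl a ā w w̄)

-- Functionals on Laurent polynomials

module Sequences {c ℓ} (R : CommutativeRing c ℓ) (t : CommutativeRing.Carrier R) where

  open CommutativeRing R hiding (zero)
  open import Algebra.Definitions.RawSemiring (Semiring.rawSemiring semiring) using (_^_)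
  open import Algebra.Properties.Ring ring using (-0#≈0#)
  open import Relation.Binary.Reasoning.Setoid setoid
  open IntegerSolver R using (solve; _:+_; _:*_; _:-_; :-_; _:=_; :0; :1; combine₁; combine₃)
  open Polynomials R

  Sequence : Set c
  Sequence = ℤ → Carrier

  up down : ℤ → ℤ
  up   = ℤ.suc
  down = ℤ.pred

  infix 8 ⁻_
  ⁻_ : ℕ → ℤ
  ⁻ k = ℤ.- + k

  up-⁻ : ∀ k → up (⁻ suc k) ≡ ⁻ k
  up-⁻ zero    = ≡.refl
  up-⁻ (suc k) = ≡.refl

  down-⁻ : ∀ k → down (⁻ k) ≡ ⁻ suc k
  down-⁻ zero    = ≡.refl
  down-⁻ (suc k) = ≡.refl

  -- A sequence σ is read as the functional uⁱ ↦ σᵢ on Laurent polynomials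
  -- in u, and this operator as multiplication by ζ = u + u⁻¹.
  T : LinearOperator ℤ
  T = record
    { op      = λ f i → f (up i) + f (down i)
    ; op-cong = λ f≈g i → +-cong (f≈g (up i)) (f≈g (down i))
    ; op-+    = λ f g i → solve 4 (λ a b c d → (a :+ b) :+ (c :+ d) := (a :+ c) :+ (b :+ d)) refl _ _ _ _
    ; op-*    = λ k f i → sym (distribˡ k _ _)
    }

  -- The functional is odd under i ↦ 2 - i, that is, it kills u times every Laurent polynomial
  -- symmetric in u and u⁻¹. The fixed index 1 needs its own condition, since oddness alone gives
  -- only 2 f₁ = 0.
  Antisymmetric : Sequence → Set ℓ
  Antisymmetric f = f (+ 1) ≈ 0# × (∀ r → f (+ (2 ℕ.+ r)) ≈ - f (⁻ r))

  T-antisymmetric : ∀ f → Antisymmetric f → Antisymmetric (op T f)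
  T-antisymmetric f (f₁ , f₂) = trans (+-congʳ (f₂ 0)) (-‿inverseˡ _) , λ where
    zero    → trans (+-cong (f₂ 1) f₁)
                (combine₁ 1# f₁ (solve 2 (λ x y → :- y :+ :0 :- :- (x :+ y) := :1 :* (x :- :0)) refl _ _))
    (suc r) → trans (+-cong (f₂ (suc (suc r))) (f₂ r))
                (trans (solve 2 (λ x y → :- x :+ :- y := :- (y :+ x)) refl _ _)
                  (-‿cong (+-congʳ (reflexive (≡.cong f (≡.sym (up-⁻ r)))))))

  apply-antisymmetric : ∀ {n} (p : Poly n) f → Antisymmetric f → Antisymmetric (apply T p f)
  apply-antisymmetric []      f f-anti = refl , λ r → sym -0#≈0#
  apply-antisymmetric (a ∷ p) f f-anti@(f₁ , f₂) =
      trans (+-cong (*-congˡ f₁) (proj₁ tail)) (trans (+-identityʳ _) (zeroʳ a))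
    , λ r → trans (+-cong (*-congˡ (f₂ r)) (proj₂ tail r))
              (solve 3 (λ a x y → a :* (:- x) :+ :- y := :- (a :* x :+ y)) refl a _ _)
    where
    tail : Antisymmetric (op T (apply T p f))
    tail = T-antisymmetric (apply T p f) (apply-antisymmetric p f f-anti)

  -- Formally tⁱ fᵢ = g₋ᵢ for all integers i, stated without negative powers of t.
  record Twisted (f g : Sequence) : Set ℓ where
    field
      at-+ : ∀ k → t ^ k * f (+ k) ≈ g (⁻ k)
      at-⁻ : ∀ k → f (⁻ k) ≈ t ^ k * g (+ k)

  open Twisted

  -- Twisting carries u on the side of f to t⁻¹ u⁻¹ on the side of g, so multiplication by t z + t²
  -- u + u⁻¹ becomes multiplication by t (z + u⁻¹ + u).
  twisted-step : ∀ {f g f′ g′} z →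
    (∀ i → f′ i ≈ t * z * f i + (t * t * f (up i) + f (down i))) →
    (∀ i → g′ i ≈ t * (z * g i + (g (up i) + g (down i)))) →
    Twisted f g → Twisted f′ g′
  twisted-step {f} {g} {f′} {g′} z f′≈ g′≈ fg = record { at-+ = plus ; at-⁻ = minus }
    where
    up-at : ∀ (f : Sequence) k → f (up (⁻ suc k)) ≈ f (⁻ k)
    up-at f k = reflexive (≡.cong f (up-⁻ k))

    down-at : ∀ (f : Sequence) k → f (down (⁻ k)) ≈ f (⁻ suc k)
    down-at f k = reflexive (≡.cong f (down-⁻ k))

    plus : ∀ k → t ^ k * f′ (+ k) ≈ g′ (⁻ k)
    plus zero = trans (*-congˡ (f′≈ (+ 0))) (trans
      (combine₃ (t * z) t 1# (at-+ fg 0) (at-+ fg 1) (at-⁻ fg 1)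
        (solve 8 (λ t z f₀ f₁ f₋ g₀ g₁ g₋ →
             :1 :* (t :* z :* f₀ :+ (t :* t :* f₁ :+ f₋)) :- t :* (z :* g₀ :+ (g₁ :+ g₋))
          := t :* z :* (:1 :* f₀ :- g₀) :+ t :* (t :* :1 :* f₁ :- g₋) :+ :1 :* (f₋ :- t :* :1 :* g₁))
         refl t z _ _ _ _ _ _))
      (sym (g′≈ (+ 0))))
    plus (suc k) = trans (*-congˡ (f′≈ (+ suc k))) (trans
      (combine₃ (t * z) t t (at-+ fg (suc k)) (at-+ fg (suc (suc k))) (at-+ fg k)
        (solve 9 (λ t τ z f₀ f₁ f₋ g₀ g₁ g₋ →
             t :* τ :* (t :* z :* f₀ :+ (t :* t :* f₁ :+ f₋)) :- t :* (z :* g₀ :+ (g₁ :+ g₋))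
          := t :* z :* (t :* τ :* f₀ :- g₀) :+ t :* (t :* (t :* τ) :* f₁ :- g₋) :+ t :* (τ :* f₋ :- g₁))
         refl t (t ^ k) z _ _ _ _ _ _))
      (sym (trans (g′≈ (⁻ suc k)) (*-congˡ (+-congˡ (+-cong (up-at g k) (down-at g (suc k))))))))

    minus : ∀ k → f′ (⁻ k) ≈ t ^ k * g′ (+ k)
    minus zero    = trans (sym (*-identityˡ _)) (trans (plus zero) (sym (*-identityˡ _)))
    minus (suc k) = trans
      (trans (f′≈ (⁻ suc k)) (+-congˡ (+-cong (*-congˡ (up-at f k)) (down-at f (suc k)))))
      (trans (combine₃ (t * z) (t * t) 1# (at-⁻ fg (suc k)) (at-⁻ fg k) (at-⁻ fg (suc (suc k)))
        (solve 9 (λ t τ z f₀ f₁ f₋ g₀ g₁ g₋ →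
             t :* z :* f₀ :+ (t :* t :* f₁ :+ f₋) :- t :* τ :* (t :* (z :* g₀ :+ (g₁ :+ g₋)))
          := t :* z :* (f₀ :- t :* τ :* g₀) :+ t :* t :* (f₁ :- τ :* g₋) :+ :1 :* (f₋ :- t :* (t :* τ) :* g₁))
         refl t (t ^ k) z _ _ _ _ _ _))
      (*-congˡ (sym (g′≈ (+ suc k)))))

  twisted-cong : ∀ {f g f′ g′} → (∀ i → f′ i ≈ f i) → (∀ i → g′ i ≈ g i) → Twisted f g → Twisted f′ g′
  twisted-cong f′≈f g′≈g fg = record
    { at-+ = λ k → trans (*-congˡ (f′≈f (+ k))) (trans (at-+ fg k) (sym (g′≈g (⁻ k))))
    ; at-⁻ = λ k → trans (f′≈f (⁻ k)) (trans (at-⁻ fg k) (*-congˡ (sym (g′≈g (+ k)))))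
    }

-- Moments of H and E under the theta functionals

module Moments {c ℓ} (R : CommutativeRing c ℓ) (t : CommutativeRing.Carrier R) where

  open CommutativeRing R hiding (zero)
  open import Algebra.Definitions.RawSemiring (Semiring.rawSemiring semiring) using (_^_)
  open import Algebra.Properties.Ring ring using (-0#≈0#)
  open import Relation.Binary.Reasoning.Setoid setoid
  open IntegerSolver R using (solve; _:+_; _:*_; _:-_; :-_; _:=_; :0; :1; combine₁; combine₃)
  open Polynomials R
  open Sequences R t
  open Twisted

  module _ (s : Carrier) (σ : Sequence) where

    open Recursion R t s using (H; G; κ; apply-H; apply-G)

    X : ∀ {n} → (Fin n → Carrier) → Sequence
    X z i = apply T (H z) σ i + apply T (G z) σ (up i)

    -- Splitting (t² u + u⁻¹)(H + u G) with u⁻¹ = ζ - u and u² = ζ u - 1 is what produces the terms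
    -- with 1 - t² in `H` and `G`; here the two halves are put together again and these terms
    -- cancel.
    X-suc : ∀ {n} (z : Fin (suc n) → Carrier) i →
      X z i ≈ t * z zero * X (z ∘ suc) i + (t * t * X (z ∘ suc) (up i) + X (z ∘ suc) (down i))
            + (z zero * apply T (E (z ∘ suc)) σ i + κ n * apply T (E (z ∘ suc)) σ (up i))
    X-suc {n} z i = begin
      X z i
        ≈⟨ +-cong (apply-H T z σ i) (trans (apply-G T z σ (up i))
             (+-congʳ (+-congˡ (*-congˡ (+-congˡ (reflexive (≡.cong g (ℤ.pred-suc i)))))))) ⟩
      (t * z zero * h i + 1# * (h (up i) + h (down i)) + (z zero * e i + (1# - t * t) * g i))
        + (t * z zero * g (up i) + t * t * (g (up (up i)) + g i) + (κ n * e (up i) + - (1# - t * t) * h (up i)))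
        ≈⟨ solve 10 (λ tz q h hᵤ hₙ g gᵤ gᵤᵤ e e′ →
             (tz :* h :+ :1 :* (hᵤ :+ hₙ) :+ (e :+ (:1 :- q) :* g))
               :+ (tz :* gᵤ :+ q :* (gᵤᵤ :+ g) :+ (e′ :+ :- (:1 :- q) :* hᵤ))
          := tz :* (h :+ gᵤ) :+ (q :* (hᵤ :+ gᵤᵤ) :+ (hₙ :+ g)) :+ (e :+ e′))
           refl (t * z zero) (t * t) (h i) (h (up i)) (h (down i)) (g i) (g (up i)) (g (up (up i)))
           (z zero * e i) (κ n * e (up i)) ⟩
      t * z zero * X (z ∘ suc) i + (t * t * X (z ∘ suc) (up i) + (h (down i) + g i))
            + (z zero * e i + κ n * e (up i))
        ≈⟨ +-congʳ (+-congˡ (+-congˡ (+-congˡ (reflexive (≡.cong g (≡.sym (ℤ.suc-pred i))))))) ⟩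
      t * z zero * X (z ∘ suc) i + (t * t * X (z ∘ suc) (up i) + X (z ∘ suc) (down i))
            + (z zero * e i + κ n * e (up i)) ∎
      where
      h = apply T (H (z ∘ suc)) σ
      g = apply T (G (z ∘ suc)) σ
      e = apply T (E (z ∘ suc)) σ

    -- The summand of G is u times a polynomial in ζ, hence killed by σ.
    X≈H : Antisymmetric σ → ∀ {n} (z : Fin n → Carrier) → X z (+ 0) ≈ apply T (H z) σ (+ 0)
    X≈H anti z = trans (+-congˡ (proj₁ (apply-antisymmetric (G z) σ anti))) (+-identityʳ _)

  module _ (σ : Sequence) (anti : Antisymmetric σ) where

    module Case-t (twisted : Twisted σ σ) where

      open Recursion R t t using (H)

      private
        e x h : ∀ {n} → (Fin n → Carrier) → Sequence
        e z = apply T (E z) σ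
        x = X t σ
        h z i = e z i - (1# - t) * x z i

      -- E - (1 - t) X is the product of the factors t (zᵢ + t u + (t u)⁻¹), that is tⁿ E after u ↦
      -- t u, and twisting undoes this substitution. Index 0 is the one needed for `moment`.
      twisted-h : ∀ {n} (z : Fin n → Carrier) → Twisted (h z) (λ i → t ^ n * e z i)
      twisted-h {zero} z = twisted-cong
        (λ i → trans (+-congʳ (apply-1 T z σ i)) (solve 2 (λ t x → x :- (:1 :- t) :* (:0 :+ :0) := x) refl t (σ i)))
        (λ i → trans (*-identityˡ _) (apply-1 T z σ i))
        twisted
      twisted-h {suc n} z = twisted-step (z zero)
        (λ i → trans (+-cong (apply-E T z σ i) (-‿cong (*-congˡ (X-suc t σ z i))))
          (solve 9 (λ t τ z e eᵤ eₙ x xᵤ xₙ →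
              z :* e :+ (eᵤ :+ eₙ) :- (:1 :- t) :* (t :* z :* x :+ (t :* t :* xᵤ :+ xₙ)
                                                     :+ (z :* e :+ (:1 :+ t :- (t :- t) :* τ) :* eᵤ))
           := t :* z :* (e :- (:1 :- t) :* x)
              :+ (t :* t :* (eᵤ :- (:1 :- t) :* xᵤ) :+ (eₙ :- (:1 :- t) :* xₙ)))
            refl t (t ^ n) (z zero) (e z′ i) (e z′ (up i)) (e z′ (down i)) (x z′ i) (x z′ (up i)) (x z′ (down i))))
        (λ i → trans (*-congˡ (apply-E T z σ i))
          (solve 6 (λ t τ z e eᵤ eₙ → t :* τ :* (z :* e :+ (eᵤ :+ eₙ))
              := t :* (z :* (τ :* e) :+ (τ :* eᵤ :+ τ :* eₙ)))
            refl t (t ^ n) (z zero) (e z′ i) (e z′ (up i)) (e z′ (down i))))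
        (twisted-h z′)
        where
        z′ = z ∘ suc

      moment : ∀ {n} (z : Fin n → Carrier) →
               (1# - t) * apply T (H z) σ (+ 0) ≈ (1# - t ^ n) * apply T (E z) σ (+ 0)
      moment {n} z = trans (*-congˡ (sym (X≈H t σ anti z)))
        (combine₁ (- 1#) (at-⁻ (twisted-h z) 0)
          (solve 4 (λ t τ e x → (:1 :- t) :* x :- (:1 :- τ) :* e
              := (:- :1) :* ((e :- (:1 :- t) :* x) :- :1 :* (τ :* e)))
            refl t (t ^ n) (e z (+ 0)) (x z (+ 0))))

    -- The sequence j - t u² j + g is (up to an index shift) twisted to g; the
    -- other fields sharpen this to the vanishing of j₀.
    record Linked (j g : Sequence) : Set ℓ where
      field
        j-0     : j (+ 0) ≈ 0#
        j-⁻     : ∀ k → j (⁻ k) ≈ - (t ^ k * j (+ k))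
        j-1     : t * j (+ 1) ≈ g (-[1+ 0 ])
        twisted : Twisted (λ i → j (down i) - t * j (up (up (down i))) + g (down i)) (λ i → - g (down i))

    open Linked

    -- With g the moments of tⁿ E, the sequence j stands for those of tⁿ (E(t u) - E(u)) / (1 - t
    -- u²). The summand (1 - t) u⁻¹ g appears because the factors t z + t² u + u⁻¹ and t (z + ζ) of
    -- the two products differ by (1 - t) u⁻¹ (1 - t u²). The symmetry u ↦ (t u)⁻¹ explains `j-⁻`,
    -- but it yields only 2 j₀ = 0 and 2 t j₁ = 2 g₋₁. As 2 may vanish, `j-0` and `j-1` are passed
    -- on too: the new `j-0` rests on the old `j-1`, the new `j-1` on the old `j-0` and on
    -- `twisted`.
    linked-step : ∀ {j g j′ g′} z →
      (∀ i → j′ i ≈ t * z * j i + (t * t * j (up i) + j (down i)) + (1# - t) * g (down i)) →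
      (∀ i → g′ i ≈ t * (z * g i + (g (up i) + g (down i)))) →
      Linked j g → Linked j′ g′
    linked-step {j} {g} {j′} {g′} z j′≈ g′≈ l = record
      { j-0 = j′-0 ; j-⁻ = j′-⁻ ; j-1 = j′-1
      ; twisted = twisted-step z
          (λ i → trans (h′≈ (down i)) (+-congˡ (+-congʳ (*-congˡ (reflexive (≡.cong h (up-down i)))))))
          (λ i → trans (-‿cong (g′≈ (down i))) (trans
            (solve 5 (λ t z g gᵤ gₙ → :- (t :* (z :* g :+ (gᵤ :+ gₙ))) := t :* (z :* (:- g) :+ (:- gᵤ :+ :- gₙ)))
               refl t z _ _ _)
            (*-congˡ (+-congˡ (+-congʳ (-‿cong (reflexive (≡.cong g (up-down i)))))))))
          (twisted l)
      }
      where
      h h′ : Sequence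
      h  i = j i - t * j (up (up i)) + g i
      h′ i = j′ i - t * j′ (up (up i)) + g′ i

      up-down : ∀ i → up (down i) ≡ down (up i)
      up-down i = ≡.trans (ℤ.suc-pred i) (≡.sym (ℤ.pred-suc i))

      h′≈ : ∀ i → h′ i ≈ t * z * h i + (t * t * h (up i) + h (down i))
      h′≈ i = trans
        (+-cong (+-cong (j′≈ i) (-‿cong (*-congˡ (trans (j′≈ (up (up i)))
            (+-cong (+-congˡ (+-congˡ (reflexive (≡.cong j (ℤ.pred-suc (up i))))))
                    (*-congˡ (reflexive (≡.cong g (ℤ.pred-suc (up i)))))))))) (g′≈ i))
        (trans
          (solve 10 (λ t z j jᵤ jₙ jᵤᵤ jᵤᵤᵤ g gᵤ gₙ →
              t :* z :* j :+ (t :* t :* jᵤ :+ jₙ) :+ (:1 :- t) :* gₙ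
                :- t :* (t :* z :* jᵤᵤ :+ (t :* t :* jᵤᵤᵤ :+ jᵤ) :+ (:1 :- t) :* gᵤ)
                :+ t :* (z :* g :+ (gᵤ :+ gₙ))
           := t :* z :* (j :- t :* jᵤᵤ :+ g)
                :+ (t :* t :* (jᵤ :- t :* jᵤᵤᵤ :+ gᵤ) :+ (jₙ :- t :* jᵤ :+ gₙ)))
            refl t z (j i) (j (up i)) (j (down i)) (j (up (up i))) (j (up (up (up i)))) (g i) (g (up i)) (g (down i)))
          (+-congˡ (+-congˡ (+-congʳ (+-congˡ (-‿cong (*-congˡ
            (reflexive (≡.cong (j ∘ up) (≡.sym (ℤ.suc-pred i)))))))))))

      reflection : ∀ k → t * t ^ k * (j (+ k) - t * j (+ suc (suc k)) + g (+ k)) ≈ - g (-[1+ suc k ])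
      reflection k = at-+ (twisted l) (suc k)

      j′-0 : j′ (+ 0) ≈ 0#
      j′-0 = trans (j′≈ (+ 0)) (combine₃ (t * z) 1# (- (1# - t)) (j-0 l) (j-⁻ l 1) (j-1 l)
        (solve 6 (λ t z j₀ j₁ j₋ g₋ → t :* z :* j₀ :+ (t :* t :* j₁ :+ j₋) :+ (:1 :- t) :* g₋ :- :0
           := t :* z :* (j₀ :- :0) :+ :1 :* (j₋ :- :- (t :* :1 :* j₁)) :+ (:- (:1 :- t)) :* (t :* j₁ :- g₋))
         refl t z _ _ _ _))

      j′-1 : t * j′ (+ 1) ≈ g′ (-[1+ 0 ])
      j′-1 = trans (*-congˡ (j′≈ (+ 1))) (trans
        (combine₃ (t * z) (t + t * t) (- t) (j-1 l) (j-0 l) (reflection 0)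
          (solve 8 (λ t z j₀ j₁ j₂ g₀ g₋₁ g₋₂ →
              t :* (t :* z :* j₁ :+ (t :* t :* j₂ :+ j₀) :+ (:1 :- t) :* g₀) :- t :* (z :* g₋₁ :+ (g₀ :+ g₋₂))
           := t :* z :* (t :* j₁ :- g₋₁) :+ (t :+ t :* t) :* (j₀ :- :0)
              :+ (:- t) :* (t :* :1 :* (j₀ :- t :* j₂ :+ g₀) :- :- g₋₂))
           refl t z _ _ _ _ _ _))
        (sym (g′≈ -[1+ 0 ])))

      j′-⁻ : ∀ k → j′ (⁻ k) ≈ - (t ^ k * j′ (+ k))
      j′-⁻ zero    = trans j′-0 (sym (trans (-‿cong (trans (*-identityˡ _) j′-0)) -0#≈0#))
      j′-⁻ (suc k) = trans
        (trans (j′≈ (⁻ suc k)) (+-congʳ (+-cong (*-congˡ (j-⁻ l (suc k)))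
          (+-cong (*-congˡ (trans (reflexive (≡.cong j (up-⁻ k))) (j-⁻ l k))) (j-⁻ l (suc (suc k)))))))
        (trans
          (combine₁ (1# - t) (reflection k)
            (solve 8 (λ t τ z j₀ j₁ j₂ g₀ g₋₂ →
                t :* z :* (:- (t :* τ :* j₁)) :+ (t :* t :* (:- (τ :* j₀)) :+ :- (t :* (t :* τ) :* j₂)) :+ (:1 :- t) :* g₋₂
                  :- :- (t :* τ :* (t :* z :* j₁ :+ (t :* t :* j₂ :+ j₀) :+ (:1 :- t) :* g₀))
             := (:1 :- t) :* (t :* τ :* (j₀ :- t :* j₂ :+ g₀) :- :- g₋₂))
             refl t (t ^ k) z _ _ _ _ _))
          (-‿cong (*-congˡ (sym (j′≈ (+ suc k))))))

    -- At index 0 the relation `twisted₀` says only 2 σ₋₁ = 0, so `σ₋₁≈0` is asked for separately;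
    -- it starts the induction for `j-1`.
    module Case-0 (σ₋₁≈0 : σ (-[1+ 0 ]) ≈ 0#)
                  (twisted₀ : Twisted (σ ∘ down) (λ i → - σ (down i))) where

      open Recursion R t 0# using (H)

      private
        e x j : ∀ {n} → (Fin n → Carrier) → Sequence
        e z = apply T (E z) σ
        x = X 0# σ
        j {n} z i = (1# - t ^ n) * e z i - (1# - t) * x z i

      -- For s = 0 the closed form of X reads (1 - t u²) J + tⁿ E(u) = tⁿ E(t u) with J = (1 - tⁿ) E
      -- - (1 - t) X, and `moment` amounts to the vanishing of J under σ.
      linked : ∀ {n} (z : Fin n → Carrier) → Linked (j z) (λ i → t ^ n * e z i)
      linked {zero} z = record
        { j-0 = j≈0 (+ 0)
        ; j-⁻ = λ k → trans (j≈0 (⁻ k)) (sym (trans (-‿cong (trans (*-congˡ (j≈0 (+ k))) (zeroʳ _))) -0#≈0#))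
        ; j-1 = trans (*-congˡ (j≈0 (+ 1))) (trans (zeroʳ t) (sym (trans (g≈σ -[1+ 0 ]) σ₋₁≈0)))
        ; twisted = twisted-cong
            (λ i → trans (+-cong (+-cong (j≈0 (down i)) (-‿cong (*-congˡ (j≈0 (up (up (down i))))))) (g≈σ (down i)))
              (solve 2 (λ t x → :0 :- t :* :0 :+ x := x) refl t _))
            (λ i → -‿cong (g≈σ (down i)))
            twisted₀
        }
        where
        j≈0 : ∀ i → j z i ≈ 0#
        j≈0 i = solve 2 (λ t e → (:1 :- :1) :* e :- (:1 :- t) :* (:0 :+ :0) := :0) refl t (e z i)

        g≈σ : ∀ i → 1# * e z i ≈ σ i
        g≈σ i = trans (*-identityˡ _) (apply-1 T z σ i)
      linked {suc n} z = linked-step (z zero)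
        (λ i → trans (+-cong (*-congˡ (apply-E T z σ i)) (-‿cong (*-congˡ (X-suc 0# σ z i))))
          (solve 9 (λ t τ z e eᵤ eₙ x xᵤ xₙ →
              (:1 :- t :* τ) :* (z :* e :+ (eᵤ :+ eₙ)) :- (:1 :- t) :* (t :* z :* x :+ (t :* t :* xᵤ :+ xₙ)
                                                     :+ (z :* e :+ (:1 :+ t :- (t :- :0) :* τ) :* eᵤ))
           := t :* z :* ((:1 :- τ) :* e :- (:1 :- t) :* x)
              :+ (t :* t :* ((:1 :- τ) :* eᵤ :- (:1 :- t) :* xᵤ) :+ ((:1 :- τ) :* eₙ :- (:1 :- t) :* xₙ))
              :+ (:1 :- t) :* (τ :* eₙ))
            refl t (t ^ n) (z zero) (e z′ i) (e z′ (up i)) (e z′ (down i)) (x z′ i) (x z′ (up i)) (x z′ (down i))))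
        (λ i → trans (*-congˡ (apply-E T z σ i))
          (solve 6 (λ t τ z e eᵤ eₙ → t :* τ :* (z :* e :+ (eᵤ :+ eₙ))
              := t :* (z :* (τ :* e) :+ (τ :* eᵤ :+ τ :* eₙ)))
            refl t (t ^ n) (z zero) (e z′ i) (e z′ (up i)) (e z′ (down i))))
        (linked z′)
        where
        z′ = z ∘ suc

      moment : ∀ {n} (z : Fin n → Carrier) →
               (1# - t) * apply T (H z) σ (+ 0) ≈ (1# - t ^ n) * apply T (E z) σ (+ 0)
      moment {n} z = trans (*-congˡ (sym (X≈H 0# σ anti z)))
        (combine₁ (- 1#) (j-0 (linked z))
          (solve 4 (λ t τ e x → (:1 :- t) :* x :- (:1 :- τ) :* e
              := (:- :1) :* (((:1 :- τ) :* e :- (:1 :- t) :* x) :- :0))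
            refl t (t ^ n) (e z (+ 0)) (x z (+ 0))))

-- Theta functionals and their expansion in symmetric coefficients

module Pairing {c ℓ} (R : CommutativeRing c ℓ) (t : CommutativeRing.Carrier R) where

  open CommutativeRing R hiding (zero)
  open import Algebra.Definitions.RawSemiring (Semiring.rawSemiring semiring) using (_^_)
  open import Algebra.Properties.Semiring.Exp semiring using (^-homo-*)
  open import Algebra.Properties.Ring ring using (-0#≈0#)
  open import Relation.Binary.Reasoning.Setoid setoid
  open IntegerSolver R using (solve; _:+_; _:*_; _:-_; :-_; _:=_; :0; :1; combine₁)
  open Polynomials R
  open Sequences R t
  open Twisted

  Σ< : ℕ → (ℕ → Carrier) → Carrier
  Σ< zero    h = 0#
  Σ< (suc M) h = Σ< M h + h M

  Σ<-cong : ∀ M {h k : ℕ → Carrier} → (∀ r → h r ≈ k r) → Σ< M h ≈ Σ< M k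
  Σ<-cong zero    h≈k = refl
  Σ<-cong (suc M) h≈k = +-cong (Σ<-cong M h≈k) (h≈k M)

  Σ<-+ : ∀ M (h k : ℕ → Carrier) → Σ< M (λ r → h r + k r) ≈ Σ< M h + Σ< M k
  Σ<-+ zero    h k = sym (+-identityˡ 0#)
  Σ<-+ (suc M) h k = trans (+-congʳ (Σ<-+ M h k))
    (solve 4 (λ a b c d → a :+ b :+ (c :+ d) := a :+ c :+ (b :+ d)) refl _ _ _ _)

  Σ<-* : ∀ M k (h : ℕ → Carrier) → Σ< M (λ r → k * h r) ≈ k * Σ< M h
  Σ<-* zero    k h = sym (zeroʳ k)
  Σ<-* (suc M) k h = trans (+-congʳ (Σ<-* M k h)) (sym (distribˡ k _ _))

  Σ<-cons : ∀ M (h : ℕ → Carrier) → Σ< (suc M) h ≈ h 0 + Σ< M (h ∘ suc)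
  Σ<-cons zero    h = +-comm _ _
  Σ<-cons (suc M) h = trans (+-congʳ (Σ<-cons M h)) (+-assoc _ _ _)

  Symmetric : Sequence → Set ℓ
  Symmetric g = ∀ k → g (⁻ k) ≈ g (+ k)

  Bounded : ℕ → Sequence → Set ℓ
  Bounded m g = ∀ k → m ℕ.< k → g (+ k) ≈ 0#

  shifted : Carrier → Sequence → Sequence
  shifted z g i = z * g i + op T g i

  shifted-symmetric : ∀ z g → Symmetric g → Symmetric (shifted z g)
  shifted-symmetric z g g-sym zero    = refl
  shifted-symmetric z g g-sym (suc k) = +-cong (*-congˡ (g-sym (suc k))) (trans (+-comm _ _)
    (+-cong (trans (reflexive (≡.cong g (down-⁻ (suc k)))) (g-sym (suc (suc k))))
            (trans (reflexive (≡.cong g (up-⁻ k))) (g-sym k))))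

  shifted-bounded : ∀ z g {m} → Bounded m g → Bounded (suc m) (shifted z g)
  shifted-bounded z g g-bd (suc k) (s≤s m<k) = trans
    (+-cong (trans (*-congˡ (g-bd (suc k) (ℕ.m<n⇒m<1+n m<k))) (zeroʳ z))
      (+-cong (g-bd (suc (suc k)) (ℕ.m<n⇒m<1+n (ℕ.m<n⇒m<1+n m<k))) (g-bd k m<k)))
    (solve 0 (:0 :+ (:0 :+ :0) := :0) refl)

  -- For symmetric g this is the coefficient of u⁻ʳ + u²⁻ʳ + ... + uʳ at i = r. On that sum an
  -- antisymmetric f takes the value f₋ᵣ, since the exponents from 2 - r to r cancel under i ↦ 2 -
  -- i.
  Δ : Sequence → Sequence
  Δ g i = g i - g (up (up i))

  Δ-shifted : ∀ z g i → Δ (shifted z g) i ≈ shifted z (Δ g) i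
  Δ-shifted z g i = trans
    (+-congˡ (-‿cong (+-congˡ (+-congˡ (reflexive (≡.cong g
      (≡.trans (ℤ.pred-suc (up i)) (≡.cong up (≡.sym (ℤ.suc-pred i))))))))))
    (solve 7 (λ z g gᵤ gₙ gᵤᵤ gᵤᵤᵤ gᵤₙ → z :* g :+ (gᵤ :+ gₙ) :- (z :* gᵤᵤ :+ (gᵤᵤᵤ :+ gᵤₙ))
       := z :* (g :- gᵤᵤ) :+ ((gᵤ :- gᵤᵤᵤ) :+ (gₙ :- gᵤₙ))) refl _ _ _ _ _ _ _)

  -- The functional f applied to the symmetric Laurent polynomial with
  -- coefficients g, expanded in u⁻ʳ + u²⁻ʳ + … + uʳ.
  pairing : ℕ → Sequence → Sequence → Carrier
  pairing M f g = Σ< M (λ r → f (⁻ r) * Δ g (+ r))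

  -- Multiplication by ζ is self-adjoint for `pairing` up to boundary terms at M. At the lower end
  -- there are none, because f₁ = 0 and Δ g₋₁ = g₋₁ - g₁ = 0.
  summation-by-parts : ∀ M {f g} → Antisymmetric f → Symmetric g →
    Σ< M (λ r → op T f (⁻ r) * Δ g (+ r)) + f (up (⁻ M)) * Δ g (+ M)
      ≈ Σ< M (λ r → f (⁻ r) * op T (Δ g) (+ r)) + f (⁻ M) * Δ g (down (+ M))
  summation-by-parts zero {f} {g} (f₁ , _) g-sym = +-congˡ (trans (trans (*-congʳ f₁) (zeroˡ _))
    (sym (trans (*-congˡ (trans (+-congʳ (g-sym 1)) (-‿inverseʳ _))) (zeroʳ _))))
  summation-by-parts (suc M) {f} {g} f-anti g-sym = trans
    (+-cong (+-congˡ (*-congʳ (+-congˡ (reflexive (≡.cong f (down-⁻ M))))))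
            (*-congʳ (reflexive (≡.cong f (up-⁻ M)))))
    (combine₁ 1# (summation-by-parts M {f} {g} f-anti g-sym)
      (solve 8 (λ L Q fᵤ f₀ fₙ d d₊ d₋ →
           (L :+ (fᵤ :+ fₙ) :* d :+ f₀ :* d₊) :- (Q :+ f₀ :* (d₊ :+ d₋) :+ fₙ :* d)
        := :1 :* ((L :+ fᵤ :* d) :- (Q :+ f₀ :* d₋)))
        refl _ _ (f (up (⁻ M))) (f (⁻ M)) (f (⁻ suc M)) (Δ g (+ M)) (Δ g (+ suc M)) (Δ g (down (+ M)))))

  pairing-shifted : ∀ M z {m f g} → Antisymmetric f → Symmetric g → Bounded m g → suc m ℕ.< M →
                    pairing M (shifted z f) g ≈ pairing M f (shifted z g)
  pairing-shifted (suc M) z {m} {f} {g} f-anti g-sym g-bd (s≤s m<M) = begin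
    pairing (suc M) (shifted z f) g
      ≈⟨ trans (Σ<-cong (suc M) (λ r → solve 4 (λ z f f′ d → (z :* f :+ f′) :* d := z :* (f :* d) :+ f′ :* d) refl _ _ _ _))
           (trans (Σ<-+ (suc M) _ _) (+-congʳ (Σ<-* (suc M) z _))) ⟩
    z * pairing (suc M) f g + Σ< (suc M) (λ r → op T f (⁻ r) * Δ g (+ r))
      ≈⟨ +-congˡ (trans (sym (trans (+-congˡ (trans (*-congˡ (Δ-0 (suc M) (ℕ.m<n⇒m<1+n m<M))) (zeroʳ _))) (+-identityʳ _)))
           (trans (summation-by-parts (suc M) {f} {g} f-anti g-sym)
             (trans (+-congˡ (trans (*-congˡ (Δ-0 M m<M)) (zeroʳ _))) (+-identityʳ _)))) ⟩
    z * pairing (suc M) f g + Σ< (suc M) (λ r → f (⁻ r) * op T (Δ g) (+ r))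
      ≈⟨ trans (+-congʳ (sym (Σ<-* (suc M) z _))) (trans (sym (Σ<-+ (suc M) _ _))
           (Σ<-cong (suc M) (λ r → trans
             (solve 4 (λ z f d d′ → z :* (f :* d) :+ f :* d′ := f :* (z :* d :+ d′)) refl _ _ _ _)
             (*-congˡ (sym (Δ-shifted z g (+ r))))))) ⟩
    pairing (suc M) f (shifted z g) ∎
    where
    Δ-0 : ∀ k → m ℕ.< k → Δ g (+ k) ≈ 0#
    Δ-0 k m<k = trans (+-cong (g-bd k m<k) (-‿cong (g-bd (suc (suc k)) (ℕ.m<n⇒m<1+n (ℕ.m<n⇒m<1+n m<k)))))
      (-‿inverseʳ 0#)

  pairing-congʳ : ∀ M f {g g′} → (∀ i → g i ≈ g′ i) → pairing M f g ≈ pairing M f g′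
  pairing-congʳ M f g≈g′ = Σ<-cong M λ r → *-congˡ (+-cong (g≈g′ (+ r)) (-‿cong (g≈g′ (+ suc (suc r)))))

  pairing-congˡ : ∀ M {f f′} g → (∀ i → f i ≈ f′ i) → pairing M f g ≈ pairing M f′ g
  pairing-congˡ M g f≈f′ = Σ<-cong M λ r → *-congʳ (f≈f′ (⁻ r))

  pairing-E : ∀ M {n} (z : Fin n → Carrier) {m f g} → Antisymmetric f → Symmetric g → Bounded m g →
              m ℕ.+ n ℕ.< M → pairing M (apply T (E z) f) g ≈ pairing M f (apply T (E z) g)
  pairing-E M {zero}  z {f = f} {g} f-anti g-sym g-bd m<M = trans
    (pairing-congˡ M g (apply-1 T z f)) (pairing-congʳ M f (λ i → sym (apply-1 T z g i)))
  pairing-E M {suc n} z {m} {f} {g} f-anti g-sym g-bd m<M = begin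
    pairing M (apply T (E z) f) g
      ≈⟨ pairing-congˡ M g (apply-E T z f) ⟩
    pairing M (shifted (z zero) (apply T (E (z ∘ suc)) f)) g
      ≈⟨ pairing-shifted M (z zero) {m} {apply T (E (z ∘ suc)) f} {g} (apply-antisymmetric (E (z ∘ suc)) f f-anti) g-sym g-bd
           (ℕ.≤-<-trans (ℕ.m≤m+n (suc m) n) m+n<M) ⟩
    pairing M (apply T (E (z ∘ suc)) f) (shifted (z zero) g)
      ≈⟨ pairing-E M (z ∘ suc) {suc m} {f} {shifted (z zero) g} f-anti (shifted-symmetric (z zero) g g-sym) (shifted-bounded (z zero) g g-bd) m+n<M ⟩
    pairing M f (apply T (E (z ∘ suc)) (shifted (z zero) g))
      ≈⟨ pairing-congʳ M f (λ i → trans (apply-linear T (E (z ∘ suc)) (z zero) g i) (sym (apply-E T z g i))) ⟩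
    pairing M f (apply T (E z) g) ∎
    where
    m+n<M : suc m ℕ.+ n ℕ.< M
    m+n<M = ≡.subst (ℕ._< M) (ℕ.+-suc m n) m<M

  δ : Sequence
  δ (+ 0)      = 1#
  δ (+ suc _)  = 0#
  δ (-[1+ _ ]) = 0#

  pairing-δ : ∀ M f → pairing (suc M) f δ ≈ f (+ 0)
  pairing-δ zero    f = solve 1 (λ f → :0 :+ f :* (:1 :- :0) := f) refl (f (+ 0))
  pairing-δ (suc M) f = trans
    (+-cong (pairing-δ M f) (trans (*-congˡ (-‿inverseʳ 0#)) (zeroʳ _))) (+-identityʳ _)

  -- As ζ is symmetric in u and u⁻¹, the operator `T` is multiplication by ζ on coefficient
  -- sequences as well. So these are the coefficients of ∏ᵢ (ζ + zᵢ) as a Laurent polynomial in u.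
  coefficients : ∀ {n} → (Fin n → Carrier) → Sequence
  coefficients z = apply T (E z) δ

  coefficients-symmetric : ∀ {n} (z : Fin n → Carrier) → Symmetric (coefficients z)
  coefficients-symmetric {zero}  z k = trans (apply-1 T z δ (⁻ k)) (trans (δ-symmetric k) (sym (apply-1 T z δ (+ k))))
    where
    δ-symmetric : Symmetric δ
    δ-symmetric zero    = refl
    δ-symmetric (suc k) = refl
  coefficients-symmetric {suc n} z k = trans (apply-E T z δ (⁻ k))
    (trans (shifted-symmetric (z zero) (coefficients (z ∘ suc)) (coefficients-symmetric (z ∘ suc)) k) (sym (apply-E T z δ (+ k))))

  coefficients-bounded : ∀ {n} (z : Fin n → Carrier) → Bounded n (coefficients z)
  coefficients-bounded {zero}  z (suc k) _   = apply-1 T z δ (+ suc k)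
  coefficients-bounded {suc n} z k       n<k = trans (apply-E T z δ (+ k))
    (shifted-bounded (z zero) (coefficients (z ∘ suc)) (coefficients-bounded (z ∘ suc)) k n<k)

  -- Pairing with `δ` reads off the value at index 0; then the factors ζ + zᵢ move one by one from
  -- the functional to `δ`. Each widens the support by one, hence the bound n < M.
  pairing-coefficients : ∀ M {n} (z : Fin n → Carrier) {σ} → Antisymmetric σ → n ℕ.< M →
                         apply T (E z) σ (+ 0) ≈ pairing M σ (coefficients z)
  pairing-coefficients (suc M) z {σ} σ-anti n<M = trans (sym (pairing-δ M (apply T (E z) σ)))
    (pairing-E (suc M) z {m = 0} {σ} {δ} σ-anti δ-symmetric (λ where (suc k) _ → refl) n<M)
    where
    δ-symmetric : Symmetric δ
    δ-symmetric zero    = refl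
    δ-symmetric (suc k) = refl

  -- The antisymmetric functional taking the value ℓ r at u⁻ʳ + u²⁻ʳ + … + uʳ.
  antisymmetric : (ℕ → Carrier) → Sequence
  antisymmetric ℓ (+ 0)           = ℓ 0
  antisymmetric ℓ (+ 1)           = 0#
  antisymmetric ℓ (+ suc (suc r)) = - ℓ r
  antisymmetric ℓ (-[1+ r ])      = ℓ (suc r)

  antisymmetric-⁻ : ∀ ℓ r → antisymmetric ℓ (⁻ r) ≈ ℓ r
  antisymmetric-⁻ ℓ zero    = refl
  antisymmetric-⁻ ℓ (suc r) = refl

  antisymmetric-antisymmetric : ∀ ℓ → Antisymmetric (antisymmetric ℓ)
  antisymmetric-antisymmetric ℓ = refl , λ r → -‿cong (sym (antisymmetric-⁻ ℓ r))

  -- The values at u⁻ʳ + u²⁻ʳ + … + uʳ of the functionals u²ᵖ ↦ (-1)ᵖ tᵖ⁽ᵖ⁻¹⁾ᐟ²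
  -- and u²ᵖ ↦ (-1)ᵖ tᵖ⁽ᵖ⁻¹⁾ (both zero at odd powers of u).
  ℓ₀ ℓₜ : ℕ → Carrier
  ℓ₀ 0 = 1#
  ℓ₀ 1 = 0#
  ℓ₀ 2 = - t
  ℓ₀ 3 = 0#
  ℓ₀ (suc (suc (suc (suc r)))) = t ^ (3 ℕ.+ r) * ℓ₀ r
  ℓₜ 0 = 1#
  ℓₜ 1 = 0#
  ℓₜ (suc (suc r)) = - (t ^ (2 ℕ.+ r) * ℓₜ r)

  -- The recursion defining `ℓₜ` is the twisting relation itself, rewritten by antisymmetry; the
  -- same is true of `ℓ₀` and `twisted₀`.
  twistedₜ : Twisted (antisymmetric ℓₜ) (antisymmetric ℓₜ)
  twistedₜ = record
    { at-+ = plus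
    ; at-⁻ = λ where
        zero    → sym (*-identityˡ _)
        (suc k) → sym (plus (suc k))
    }
    where
    plus : ∀ k → t ^ k * antisymmetric ℓₜ (+ k) ≈ antisymmetric ℓₜ (⁻ k)
    plus 0             = *-identityˡ _
    plus 1             = zeroʳ _
    plus (suc (suc r)) = solve 2 (λ a b → a :* (:- b) := :- (a :* b)) refl _ _

  twisted₀ : Twisted (antisymmetric ℓ₀ ∘ down) (λ i → - antisymmetric ℓ₀ (down i))
  twisted₀ = record
    { at-+ = plus
    ; at-⁻ = λ k → combine₁ 1# (plus k)
        (solve 3 (λ τ a b → b :- τ :* (:- a) := :1 :* (τ :* a :- :- b)) refl _ _ _)
    }
    where
    plus : ∀ k → t ^ k * antisymmetric ℓ₀ (down (+ k)) ≈ - antisymmetric ℓ₀ (down (⁻ k))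
    plus 0 = trans (*-identityˡ _) (sym -0#≈0#)
    plus 1 = solve 1 (λ t → t :* :1 :* :1 := :- :- t) refl t
    plus 2 = trans (zeroʳ _) (sym -0#≈0#)
    plus (suc (suc (suc r))) = solve 2 (λ a b → a :* (:- b) := :- (a :* b)) refl _ _

  ℓ₀-odd : ∀ m → ℓ₀ (1 ℕ.+ m ℕ.* 4) ≈ 0# × ℓ₀ (3 ℕ.+ m ℕ.* 4) ≈ 0#
  ℓ₀-odd zero    = refl , refl
  ℓ₀-odd (suc m) = trans (*-congˡ (proj₁ (ℓ₀-odd m))) (zeroʳ _) , trans (*-congˡ (proj₂ (ℓ₀-odd m))) (zeroʳ _)

  ℓₜ-odd : ∀ m → ℓₜ (1 ℕ.+ m ℕ.* 4) ≈ 0# × ℓₜ (3 ℕ.+ m ℕ.* 4) ≈ 0#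
  ℓₜ-odd zero    = refl , trans (-‿cong (zeroʳ _)) -0#≈0#
  ℓₜ-odd (suc m) = step (proj₂ (ℓₜ-odd m)) , step (step (proj₂ (ℓₜ-odd m)))
    where
    step : ∀ {a b} → b ≈ 0# → - (a * b) ≈ 0#
    step b≈0 = trans (-‿cong (trans (*-congˡ b≈0) (zeroʳ _))) -0#≈0#

  ^-+ : ∀ a b {d} → a ℕ.+ b ≡ d → t ^ a * t ^ b ≈ t ^ d
  ^-+ a b a+b≡d = trans (sym (^-homo-* t a b)) (reflexive (≡.cong (t ^_) a+b≡d))

  ℓ₀-even : ∀ m → ℓ₀ (2 ℕ.+ m ℕ.* 4) ≈ - t ^ (suc m ℕ.* (1 ℕ.+ m ℕ.* 2))
                × ℓ₀ (4 ℕ.+ m ℕ.* 4) ≈ t ^ (suc m ℕ.* (3 ℕ.+ m ℕ.* 2))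
  ℓ₀-even zero    = -‿cong (sym (*-identityʳ t)) , *-identityʳ _
  ℓ₀-even (suc m) =
      trans (*-congˡ (proj₁ (ℓ₀-even m))) (trans (solve 2 (λ a b → a :* (:- b) := :- (a :* b)) refl _ _)
        (-‿cong (^-+ (5 ℕ.+ m ℕ.* 4) (suc m ℕ.* (1 ℕ.+ m ℕ.* 2))
          (ℕ-solve 1 (λ m → # 5 ⊞ m ⊠ # 4 ⊞ (# 1 ⊞ m) ⊠ (# 1 ⊞ m ⊠ # 2) ≣ (# 2 ⊞ m) ⊠ (# 1 ⊞ (# 1 ⊞ m) ⊠ # 2)) ≡.refl m))))
    , trans (*-congˡ (proj₂ (ℓ₀-even m)))
        (^-+ (7 ℕ.+ m ℕ.* 4) (suc m ℕ.* (3 ℕ.+ m ℕ.* 2))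
          (ℕ-solve 1 (λ m → # 7 ⊞ m ⊠ # 4 ⊞ (# 1 ⊞ m) ⊠ (# 3 ⊞ m ⊠ # 2) ≣ (# 2 ⊞ m) ⊠ (# 3 ⊞ (# 1 ⊞ m) ⊠ # 2)) ≡.refl m))

  ℓₜ-even : ∀ m → ℓₜ (2 ℕ.+ m ℕ.* 4) ≈ - t ^ ((2 ℕ.+ m ℕ.* 2) ℕ.* (1 ℕ.+ m ℕ.* 2))
                × ℓₜ (4 ℕ.+ m ℕ.* 4) ≈ t ^ ((2 ℕ.+ m ℕ.* 2) ℕ.* (3 ℕ.+ m ℕ.* 2))
  ℓₜ-even m = second , trans (-‿cong (*-congˡ second)) (trans (solve 2 (λ a b → :- (a :* (:- b)) := a :* b) refl _ _)
      (^-+ (4 ℕ.+ m ℕ.* 4) ((2 ℕ.+ m ℕ.* 2) ℕ.* (1 ℕ.+ m ℕ.* 2))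
        (ℕ-solve 1 (λ m → # 4 ⊞ m ⊠ # 4 ⊞ (# 2 ⊞ m ⊠ # 2) ⊠ (# 1 ⊞ m ⊠ # 2) ≣ (# 2 ⊞ m ⊠ # 2) ⊠ (# 3 ⊞ m ⊠ # 2)) ≡.refl m)))
    where
    fourth : ∀ m → ℓₜ (m ℕ.* 4) ≈ t ^ (m ℕ.* 2 ℕ.* (1 ℕ.+ m ℕ.* 2))
    fourth zero    = refl
    fourth (suc m) = proj₂ (ℓₜ-even m)
    second : ℓₜ (2 ℕ.+ m ℕ.* 4) ≈ - t ^ ((2 ℕ.+ m ℕ.* 2) ℕ.* (1 ℕ.+ m ℕ.* 2))
    second = -‿cong (trans (*-congˡ (fourth m)) (^-+ (2 ℕ.+ m ℕ.* 4) (m ℕ.* 2 ℕ.* (1 ℕ.+ m ℕ.* 2))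
      (ℕ-solve 1 (λ m → # 2 ⊞ m ⊠ # 4 ⊞ m ⊠ # 2 ⊠ (# 1 ⊞ m ⊠ # 2) ≣ (# 2 ⊞ m ⊠ # 2) ⊠ (# 1 ⊞ m ⊠ # 2)) ≡.refl m)))

  -- The blocks match the sums over y: r = 4m + 2 and r = 4m + 4 belong to y = m + 1 and y = - (m +
  -- 1) for s = 0, and to y = 2m + 2 and y = - (2m + 2) for s = t. The separate term r = 0 is y = 0.
  Σ<-blocks : ∀ M (h : ℕ → Carrier) →
    (∀ m → h (1 ℕ.+ m ℕ.* 4) ≈ 0# × h (3 ℕ.+ m ℕ.* 4) ≈ 0#) →
    Σ< (1 ℕ.+ M ℕ.* 4) h ≈ h 0 + Σ< M (λ m → h (2 ℕ.+ m ℕ.* 4) + h (4 ℕ.+ m ℕ.* 4))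
  Σ<-blocks zero    h odd = +-comm _ _
  Σ<-blocks (suc M) h odd = trans
    (+-congʳ (+-cong (+-congʳ (+-cong (Σ<-blocks M h odd) (proj₁ (odd M)))) (proj₂ (odd M))))
    (solve 4 (λ a b c d → a :+ b :+ :0 :+ c :+ :0 :+ d := a :+ (b :+ (c :+ d))) refl _ _ _ _)

-- The parts of (1ⁿ)

entry : List ℕ → ℕ → ℕ
entry []       _       = 0
entry (a ∷ as) zero    = a
entry (a ∷ as) (suc k) = entry as k

-- Partition.part is defined through a local function, which the use below
-- substitutes for the left-hand side left open here.
go-entry : ∀ (μ : Partition) as k → _ ≡ entry as k

part-entry : ∀ μ k → part μ k ≡ entry (parts μ) k
part-entry μ k with parts μ
... | as = go-entry μ as k

go-entry μ []       k       = ≡.refl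
go-entry μ (a ∷ as) zero    = ≡.refl
go-entry μ (a ∷ as) (suc k) = go-entry μ as k

part-ones : ∀ n (i : Fin n) → part (ones n) (toℕ i) ≡ 1
part-ones n i = ≡.trans (part-entry (ones n) (toℕ i)) (entry-replicate n i)
  where
  entry-replicate : ∀ n (i : Fin n) → entry (List.replicate n 1) (toℕ i) ≡ 1
  entry-replicate (suc n) zero    = ≡.refl
  entry-replicate (suc n) (suc i) = entry-replicate n i

-- Division, finite sums and products, and generic points

module FieldLemmas {c ℓ₁ ℓ₂} (K : HeytingField c ℓ₁ ℓ₂) where

  open HeytingField K using (Carrier; _≈_; _#_; heytingCommutativeRing; #⇒invertible)
  open HallLittlewood K
  R : CommutativeRing c ℓ₁
  R = HeytingCommutativeRing.commutativeRing heytingCommutativeRing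
  open CommutativeRing R hiding (zero; Carrier; _≈_)
  open import Algebra.Apartness.Properties.HeytingCommutativeRing heytingCommutativeRing
    using (x-0≈x; 1#0; x#0y#0→xy#0; #-congʳ)
  open import Algebra.Properties.CommutativeMonoid.Sum *-commutativeMonoid
    using () renaming (sum-cong-≋ to ∏-cong)
  open import Relation.Binary.Reasoning.Setoid setoid
  open IntegerSolver R using (solve; _:+_; _:*_; _:-_; :-_; _:=_; :1; combine₁; combine₂)

  inverse : ∀ {b} → b # 0# → Carrier
  inverse b#0 = proj₁ (#⇒invertible b#0)

  b*b⁻¹≈1 : ∀ {b} (b#0 : b # 0#) → b * inverse b#0 ≈ 1#
  b*b⁻¹≈1 b#0 = trans (*-congʳ (sym (x-0≈x _))) (proj₂ (proj₂ (#⇒invertible b#0)))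

  #0-cancelˡ : ∀ {b} → b # 0# → ∀ {x y} → b * x ≈ b * y → x ≈ y
  #0-cancelˡ {b} b#0 {x} {y} bx≈by = combine₂ (- (x - y)) (inverse b#0) (b*b⁻¹≈1 b#0) bx≈by
    (solve 4 (λ b c x y → x :- y := (:- (x :- y)) :* (b :* c :- :1) :+ c :* (b :* x :- b :* y)) refl b _ x y)

  ÷-* : ∀ a {b} (b#0 : b # 0#) → (a ÷ b [ b#0 ]) * b ≈ a
  ÷-* a {b} b#0 = combine₁ a (b*b⁻¹≈1 b#0)
    (solve 3 (λ a b c → a :* c :* b :- a := a :* (b :* c :- :1)) refl a b _)

  ÷-unique : ∀ {a b c} (b#0 : b # 0#) → c * b ≈ a → c ≈ a ÷ b [ b#0 ]
  ÷-unique b#0 cb≈a = #0-cancelˡ b#0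
    (trans (*-comm _ _) (trans cb≈a (trans (sym (÷-* _ b#0)) (*-comm _ _))))

  ÷-cong : ∀ {a a′ b b′} (b#0 : b # 0#) (b′#0 : b′ # 0#) → a ≈ a′ → b ≈ b′ →
           a ÷ b [ b#0 ] ≈ a′ ÷ b′ [ b′#0 ]
  ÷-cong b#0 b′#0 a≈a′ b≈b′ = ÷-unique b′#0 (trans (*-congˡ (sym b≈b′)) (trans (÷-* _ b#0) a≈a′))

  ∏-#0 : ∀ {n} (f : Fin n → Carrier) → (∀ i → f i # 0#) → ∏ f # 0#
  ∏-#0 {zero}  f f#0 = 1#0
  ∏-#0 {suc n} f f#0 = x#0y#0→xy#0 (f#0 zero) (∏-#0 (f ∘ suc) (f#0 ∘ suc))

  -- The factors of ∏< are not accessible by name; the uses below determine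
  -- the types left open in the two signatures ending in _ ≈ _.
  factor-cong : ∀ {n} (f g : ∀ (i j : Fin n) → i Fin.< j → Carrier) →
                (∀ i j p → f i j p ≈ g i j p) → ∀ i j → _ ≈ _

  ∏<-cong : ∀ {n} (f g : ∀ (i j : Fin n) → i Fin.< j → Carrier) →
            (∀ i j p → f i j p ≈ g i j p) → ∏< f ≈ ∏< g
  ∏<-cong {n} f g f≈g = ∏-cong {n} (λ i → ∏-cong {n} (λ j → factor-cong f g f≈g i j))

  factor-cong f g f≈g i j with i Fin.<? j
  ... | yes p = f≈g i j p
  ... | no  _ = refl

  factor-suc : ∀ {n} (f : ∀ (i j : Fin (suc n)) → i Fin.< j → Carrier) → ∀ i j → _ ≈ _

  ∏<-suc : ∀ {n} (f : ∀ (i j : Fin (suc n)) → i Fin.< j → Carrier) →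
           ∏< f ≈ (∏ λ k → f zero (suc k) z<s) * ∏< (λ i j i<j → f (suc i) (suc j) (s<s i<j))
  ∏<-suc {n} f = *-cong (*-identityˡ _)
    (∏-cong {n} λ i → trans (*-identityˡ _) (∏-cong {n} λ j → factor-suc f i j))

  factor-suc f i j with suc i Fin.<? suc j | i Fin.<? j
  ... | yes p  | yes q = reflexive (≡.cong (f (suc i) (suc j)) (ℕ.<-irrelevant _ _))
  ... | yes p  | no ¬q = contradiction (ℕ.s<s⁻¹ p) ¬q
  ... | no ¬p  | yes q = contradiction (s<s q) ¬p
  ... | no _   | no _  = refl

  ∑-cong : ∀ {a} {A : Set a} (as : List A) {f g : A → Carrier} → (∀ a → f a ≈ g a) → ∑ as f ≈ ∑ as g
  ∑-cong []       f≈g = refl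
  ∑-cong (a ∷ as) f≈g = +-cong (f≈g a) (∑-cong as f≈g)

  ∑-*ˡ : ∀ {a} {A : Set a} (as : List A) k (f : A → Carrier) → ∑ as (λ a → k * f a) ≈ k * ∑ as f
  ∑-*ˡ []       k f = sym (zeroʳ k)
  ∑-*ˡ (a ∷ as) k f = trans (+-congˡ (∑-*ˡ as k f)) (sym (distribˡ k _ _))

  ∑-++ : ∀ {a} {A : Set a} (as bs : List A) (f : A → Carrier) → ∑ (as ++ bs) f ≈ ∑ as f + ∑ bs f
  ∑-++ []       bs f = sym (+-identityˡ _)
  ∑-++ (a ∷ as) bs f = trans (+-congˡ (∑-++ as bs f)) (sym (+-assoc _ _ _))

  ∑-map : ∀ {a b} {A : Set a} {B : Set b} (h : A → B) as (f : B → Carrier) →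
          ∑ (List.map h as) f ≈ ∑ as (f ∘ h)
  ∑-map h []       f = refl
  ∑-map h (a ∷ as) f = +-congˡ (∑-map h as f)

  ∑-product : ∀ {a b d} {A : Set a} {B : Set b} {D : Set d} (h : A → B → D) as bs (f : D → Carrier) →
              ∑ (List.cartesianProductWith h as bs) f ≈ ∑ as λ a → ∑ bs λ b → f (h a b)
  ∑-product h []       bs f = refl
  ∑-product h (a ∷ as) bs f = trans (∑-++ (List.map (h a) bs) _ f)
    (+-cong (∑-map (h a) bs f) (∑-product h as bs f))

  ∑-tabulate : ∀ {a} {A : Set a} {n} (h : Fin n → A) (f : A → Carrier) →
               ∑ (List.tabulate h) f ≈ Polynomials.sum R (f ∘ h)
  ∑-tabulate {n = zero}  h f = refl
  ∑-tabulate {n = suc n} h f = +-congˡ (∑-tabulate (h ∘ suc) f)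

  x*x⁻¹≈1 : ∀ {n} (p : GenericPoint n) i → x p i * x⁻¹ p i ≈ 1#
  x*x⁻¹≈1 p i = trans (*-comm _ _) (x⁻¹x≈1 p i)

  x⁻¹-unique : ∀ {n} (p : GenericPoint n) i {b} → b * x p i ≈ 1# → x⁻¹ p i ≈ b
  x⁻¹-unique p i bx≈1 = sym (÷-unique (x#0 p i) bx≈1)

  x⁻¹-cong : ∀ {m n} (p : GenericPoint m) (q : GenericPoint n) {i j} → x p i ≈ x q j → x⁻¹ p i ≈ x⁻¹ q j
  x⁻¹-cong p q {i} {j} e = ÷-cong (x#0 p i) (x#0 q j) refl e

  z : ∀ {n} → GenericPoint n → Fin n → Carrier
  z p i = x p i + x⁻¹ p i

  x^±*x^∓≈1 : ∀ {n} (p : GenericPoint n) i ε → x^± p i ε * x^± p i (not ε) ≈ 1#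
  x^±*x^∓≈1 p i false = x*x⁻¹≈1 p i
  x^±*x^∓≈1 p i true  = x⁻¹x≈1 p i

  x^±+x^∓≈z : ∀ {n} (p : GenericPoint n) i ε → x^± p i ε + x^± p i (not ε) ≈ z p i
  x^±+x^∓≈z p i false = refl
  x^±+x^∓≈z p i true  = +-comm _ _

  denominator : ∀ {n} → GenericPoint n → Fin n → Fin n → Carrier
  denominator p i j = (x p i - x p j) * (1# - x p i * x p j)

  denominator#0 : ∀ {n} (p : GenericPoint n) {i j} → i ≢ j → denominator p i j # 0#
  denominator#0 p i≢j = x#0y#0→xy#0 (#⇒-#0 (x#x p i≢j)) (#⇒-#0 (1#x*x p i≢j))

  z-z : ∀ {n} (p : GenericPoint n) i j →
        z p j - z p i ≈ denominator p i j * (x⁻¹ p i * x⁻¹ p j)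
  z-z p i j = combine₂ ((a - b) * (b * b̄) - b̄) (a - b + ā) (x*x⁻¹≈1 p i) (x*x⁻¹≈1 p j)
    (solve 4 (λ a ā b b̄ → b :+ b̄ :- (a :+ ā) :- (a :- b) :* (:1 :- a :* b) :* (ā :* b̄)
       := ((a :- b) :* (b :* b̄) :- b̄) :* (a :* ā :- :1) :+ (a :- b :+ ā) :* (b :* b̄ :- :1)) refl a ā b b̄)
    where
    a = x p i
    ā = x⁻¹ p i
    b = x p j
    b̄ = x⁻¹ p j

  z-z#0 : ∀ {n} (p : GenericPoint n) {i j} → i ≢ j → z p j - z p i # 0#
  z-z#0 p {i} {j} i≢j = #-congʳ (sym (z-z p i j))
    (x#0y#0→xy#0 (denominator#0 p i≢j) (x#0y#0→xy#0 (x⁻¹#0 p i) (x⁻¹#0 p j)))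

  restrict : ∀ {m n} (h : Fin m → Fin n) → (∀ {i j} → h i ≡ h j → i ≡ j) → GenericPoint n → GenericPoint m
  restrict h inj p = record
    { x     = x p ∘ h
    ; x#0   = x#0 p ∘ h
    ; 1#x²  = 1#x² p ∘ h
    ; x#x   = λ i≢j → x#x p (i≢j ∘ inj)
    ; 1#x*x = λ i≢j → 1#x*x p (i≢j ∘ inj)
    }

  -- Abstract, so that points are not compared through the proofs they contain.
  abstract
    removeAt : ∀ {n} → GenericPoint (suc n) → Fin (suc n) → GenericPoint n
    removeAt p j = restrict (punchIn j) (Fin.punchIn-injective j _ _) p

    x-removeAt : ∀ {n} (p : GenericPoint (suc n)) j i → x (removeAt p j) i ≡ x p (punchIn j i)
    x-removeAt p j i = ≡.refl

    tail : ∀ {n} → GenericPoint (suc n) → GenericPoint n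
    tail p = restrict suc Fin.suc-injective p

    x-tail : ∀ {n} (p : GenericPoint (suc n)) i → x (tail p) i ≡ x p (suc i)
    x-tail p i = ≡.refl

    infixr 9 _•_
    _•_ : ∀ {n} → W n → GenericPoint n → GenericPoint n
    w • p = act w p

    •≡act : ∀ {n} (w : W n) (p : GenericPoint n) → w • p ≡ act w p
    •≡act w p = ≡.refl

    x-• : ∀ {n} σ ε (p : GenericPoint n) i → x ((σ , ε) • p) i ≡ x^± p (σ ⟨$⟩ʳ i) (Vec.lookup ε i)
    x-• σ ε p i = ≡.refl

  z-removeAt : ∀ {n} (p : GenericPoint (suc n)) j i → z (removeAt p j) i ≈ z p (punchIn j i)
  z-removeAt p j i = +-cong (reflexive (x-removeAt p j i)) (x⁻¹-cong (removeAt p j) p (reflexive (x-removeAt p j i)))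

  x⁻¹-• : ∀ {n} σ ε (p : GenericPoint n) i → x⁻¹ ((σ , ε) • p) i ≈ x^± p (σ ⟨$⟩ʳ i) (not (Vec.lookup ε i))
  x⁻¹-• σ ε p i = x⁻¹-unique ((σ , ε) • p) i (trans (*-congˡ (reflexive (x-• σ ε p i)))
    (trans (*-comm _ _) (x^±*x^∓≈1 p (σ ⟨$⟩ʳ i) (Vec.lookup ε i))))

  z-• : ∀ {n} σ ε (p : GenericPoint n) i → z ((σ , ε) • p) i ≈ z p (σ ⟨$⟩ʳ i)
  z-• σ ε p i = trans (+-cong (reflexive (x-• σ ε p i)) (x⁻¹-• σ ε p i))
    (x^±+x^∓≈z p (σ ⟨$⟩ʳ i) (Vec.lookup ε i))

  x^±-removeAt : ∀ {n} (p : GenericPoint (suc n)) j i ε → x^± (removeAt p j) i ε ≈ x^± p (punchIn j i) ε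
  x^±-removeAt p j i false = reflexive (x-removeAt p j i)
  x^±-removeAt p j i true  = x⁻¹-cong (removeAt p j) p (reflexive (x-removeAt p j i))

-- The sum over the Weyl group

module WeylSum {c ℓ₁ ℓ₂} (K : HeytingField c ℓ₁ ℓ₂) where

  open HeytingField K using (Carrier; _≈_; _#_)
  open HallLittlewood K
  open FieldLemmas K
  open CommutativeRing R hiding (zero; Carrier; _≈_)
  open import Algebra.Properties.CommutativeMonoid.Sum *-commutativeMonoid
    using () renaming (sum-cong-≋ to ∏-cong; ∑-distrib-+ to ∏-distrib-*; sum-permute to ∏-permute; sum-init-last to ∏-init-last)
  open import Algebra.Properties.CommutativeMonoid.Sum +-commutativeMonoid using (sum-cong-≋)
  open import Algebra.Properties.CommutativeSemigroup *-commutativeSemigroup using (interchange)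
  open import Relation.Binary.Reasoning.Setoid setoid
  open IntegerSolver R using (solve; _:+_; _:*_; _:-_; :-_; _:=_; :0; :1; combine₂)
  open Polynomials R hiding (product)
  open import Algebra.Properties.Semiring.Sum semiring using (*-distribˡ-sum)

  module _ (t s₁ s₂ s : Carrier)
           (s₁s₂ : ∀ a → (1# - s₁ * a) * (1# - s₂ * a) ≈ 1# - s * (a * a)) where

    open Recursion R t s using (H; H-root)

    weight : ∀ {n} → GenericPoint n → Fin n → Carrier
    weight q i = x⁻¹ q i * ((1# - s₁ * x q i) * (1# - s₂ * x q i) ÷ (1# - x q i * x q i) [ #⇒-#0 (1#x² q i) ])

    weight-cong : ∀ {m n} (q : GenericPoint m) (q′ : GenericPoint n) {i j} → x q i ≈ x q′ j → weight q i ≈ weight q′ j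
    weight-cong q q′ e = *-cong (x⁻¹-cong q q′ e) (÷-cong (#⇒-#0 (1#x² q _)) (#⇒-#0 (1#x² q′ _))
      (*-cong (+-congˡ (-‿cong (*-congˡ e))) (+-congˡ (-‿cong (*-congˡ e))))
      (+-congˡ (-‿cong (*-cong e e))))

    weight-unique : ∀ {n} (q : GenericPoint n) i {a ā w} → x q i ≈ a → x⁻¹ q i ≈ ā → w * (1# - a * a) ≈ 1# →
                    weight q i ≈ w * (ā * (1# - s * (a * a)))
    weight-unique q i {a} {ā} {w} x≈a x⁻¹≈ā wb≈1 = trans
      (*-cong x⁻¹≈ā (sym (÷-unique {c = w * (1# - s * (a * a))} (#⇒-#0 (1#x² q i)) (begin
        w * (1# - s * (a * a)) * (1# - x q i * x q i) ≈⟨ *-congˡ (+-congˡ (-‿cong (*-cong x≈a x≈a))) ⟩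
        w * (1# - s * (a * a)) * (1# - a * a)
          ≈⟨ solve 3 (λ w b c → w :* b :* c := w :* c :* b) refl _ _ _ ⟩
        w * (1# - a * a) * (1# - s * (a * a)) ≈⟨ trans (*-congʳ wb≈1) (*-identityˡ _) ⟩
        1# - s * (a * a) ≈⟨ sym (s₁s₂ a) ⟩
        (1# - s₁ * a) * (1# - s₂ * a)
          ≈⟨ sym (*-cong (+-congˡ (-‿cong (*-congˡ x≈a))) (+-congˡ (-‿cong (*-congˡ x≈a)))) ⟩
        (1# - s₁ * x q i) * (1# - s₂ * x q i) ∎))))
      (solve 3 (λ ā w b → ā :* (w :* b) := w :* (ā :* b)) refl _ _ _)

    β : ∀ {n} → GenericPoint n → (i j : Fin n) → i ≢ j → Carrier
    β q i j i≢j = (t * x q i - x q j) * (1# - t * (x q i * x q j)) ÷ denominator q i j [ denominator#0 q i≢j ]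

    β-cong : ∀ {m n} (q : GenericPoint m) (q′ : GenericPoint n) {i j i′ j′} i≢j i′≢j′ →
             x q i ≈ x q′ i′ → x q j ≈ x q′ j′ → β q i j i≢j ≈ β q′ i′ j′ i′≢j′
    β-cong q q′ i≢j i′≢j′ eᵢ eⱼ = ÷-cong (denominator#0 q i≢j) (denominator#0 q′ i′≢j′)
      (*-cong (+-cong (*-congˡ eᵢ) (-‿cong eⱼ)) (+-congˡ (-‿cong (*-congˡ (*-cong eᵢ eⱼ)))))
      (*-cong (+-cong eᵢ (-‿cong eⱼ)) (+-congˡ (-‿cong (*-cong eᵢ eⱼ))))

    -- Divided by xᵢ xⱼ, the numerator and the denominator of β both depend on xⱼ only through zⱼ;
    -- the denominator becomes zⱼ - zᵢ.
    β-z : ∀ {n} (q : GenericPoint n) i j i≢j →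
          β q i j i≢j * (z q j - z q i) ≈ t * z q j - (t * t * x q i + x⁻¹ q i)
    β-z q i j i≢j = begin
      β q i j i≢j * (z q j - z q i) ≈⟨ *-congˡ (z-z q i j) ⟩
      β q i j i≢j * (denominator q i j * (ā * b̄)) ≈⟨ sym (*-assoc _ _ _) ⟩
      β q i j i≢j * denominator q i j * (ā * b̄) ≈⟨ *-congʳ (÷-* _ (denominator#0 q i≢j)) ⟩
      (t * a - b) * (1# - t * (a * b)) * (ā * b̄)
        ≈⟨ combine₂ (t * b̄ - (t * t * a - t * b) * (b * b̄)) (- ā - (t * t * a - t * b)) (x*x⁻¹≈1 q i) (x*x⁻¹≈1 q j)
             (solve 5 (λ t a ā b b̄ → (t :* a :- b) :* (:1 :- t :* (a :* b)) :* (ā :* b̄)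
                 :- (t :* (b :+ b̄) :- (t :* t :* a :+ ā))
               := (t :* b̄ :- (t :* t :* a :- t :* b) :* (b :* b̄)) :* (a :* ā :- :1)
                  :+ (:- ā :- (t :* t :* a :- t :* b)) :* (b :* b̄ :- :1)) refl t a ā b b̄) ⟩
      t * z q j - (t * t * a + ā) ∎
      where
      a = x q i
      ā = x⁻¹ q i
      b = x q j
      b̄ = x⁻¹ q j

    abstract
      S : ∀ {n} → GenericPoint n → Carrier
      S {n} q = ∏ (weight q) * ∏< (λ i j i<j → β q i j (Fin.<⇒≢ i<j))

      summand≈S : ∀ {n} (q : GenericPoint n) → summandBC (ones n) t s₁ s₂ q ≈ S q
      summand≈S {n} q = *-congʳ (∏-cong {n} λ i → *-congʳ
        (trans (reflexive (≡.cong (x⁻¹ q i ^_) (part-ones n i))) (*-identityʳ _)))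

      S-0 : (q : GenericPoint 0) → S q ≈ 1#
      S-0 q = *-identityˡ 1#

      S-cong : ∀ {n} (q q′ : GenericPoint n) → (∀ i → x q i ≈ x q′ i) → S q ≈ S q′
      S-cong {n} q q′ e = *-cong
        (∏-cong {n} λ i → weight-cong q q′ (e i))
        (∏<-cong (λ i j i<j → β q i j (Fin.<⇒≢ i<j)) (λ i j i<j → β q′ i j (Fin.<⇒≢ i<j))
          λ i j i<j → β-cong q q′ (Fin.<⇒≢ i<j) (Fin.<⇒≢ i<j) (e i) (e j))

      head : ∀ {n} → GenericPoint (suc n) → Carrier
      head q = weight q zero * ∏ λ k → β q zero (suc k) (Fin.<⇒≢ z<s)

      S-suc : ∀ {n} (q : GenericPoint (suc n)) → S q ≈ head q * S (tail q)
      S-suc {n} q = begin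
        S q ≈⟨ *-congˡ (∏<-suc (λ i j i<j → β q i j (Fin.<⇒≢ i<j))) ⟩
        (weight q zero * ∏ (λ i → weight q (suc i))) * ((∏ λ k → β q zero (suc k) (Fin.<⇒≢ z<s))
           * ∏< (λ i j i<j → β q (suc i) (suc j) (Fin.<⇒≢ (s<s i<j))))
          ≈⟨ interchange _ _ _ _ ⟩
        head q * (∏ (λ i → weight q (suc i)) * ∏< (λ i j i<j → β q (suc i) (suc j) (Fin.<⇒≢ (s<s i<j))))
          ≈⟨ *-congˡ (*-cong (∏-cong {n} λ i → weight-cong q (tail q) (x≈ i))
               (∏<-cong (λ i j i<j → β q (suc i) (suc j) (Fin.<⇒≢ (s<s i<j)))
                        (λ i j i<j → β (tail q) i j (Fin.<⇒≢ i<j))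
                 λ i j i<j → β-cong q (tail q) (Fin.<⇒≢ (s<s i<j)) (Fin.<⇒≢ i<j) (x≈ i) (x≈ j))) ⟩
        head q * S (tail q) ∎
        where
        x≈ : ∀ i → x q (suc i) ≈ x (tail q) i
        x≈ i = reflexive (≡.sym (x-tail q i))

      head-z : ∀ {n} (q : GenericPoint (suc n)) →
        head q * (∏ λ k → z q (suc k) - z q zero)
          ≈ weight q zero * ∏ λ k → t * z q (suc k) - (t * t * x q zero + x⁻¹ q zero)
      head-z {n} q = trans (*-assoc _ _ _) (*-congˡ
        (trans (sym (∏-distrib-* {n} (λ k → β q zero (suc k) (Fin.<⇒≢ z<s)) (λ k → z q (suc k) - z q zero)))
          (∏-cong {n} λ k → β-z q zero (suc k) (Fin.<⇒≢ z<s))))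

    module _ {n} (p : GenericPoint (suc n)) (j : Fin (suc n)) where

      D : Carrier
      D = ∏ λ k → z p (punchIn j k) - z p j

      D#0 : D # 0#
      D#0 = ∏-#0 _ λ k → z-z#0 p (Fin.punchInᵢ≢i j k ∘ ≡.sym)

      V : Bool → Carrier
      V ε = ∏ λ k → t * z p (punchIn j k) - (t * t * x^± p j ε + x^± p j (not ε))

      abstract
        w : Bool → Carrier
        w ε = inverse (#⇒-#0 (1#±² p j ε))

        w-inverse : ∀ ε → w ε * (1# - x^± p j ε * x^± p j ε) ≈ 1#
        w-inverse ε = trans (*-comm _ _) (b*b⁻¹≈1 (#⇒-#0 (1#±² p j ε)))

      N : Bool → Carrier
      N ε = w ε * (x^± p j (not ε) * (1# - s * (x^± p j ε * x^± p j ε)) * V ε)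

      abstract
        C : Bool → Carrier
        C ε = N ε ÷ D [ D#0 ]

        C*D : ∀ ε → C ε * D ≈ N ε
        C*D ε = ÷-* (N ε) D#0

        C-unique : ∀ ε {c} → c * D ≈ N ε → c ≈ C ε
        C-unique ε = ÷-unique D#0

      -- Multiplied by `D`, the head is a product over all other variables that sees each of them
      -- only through its z. Neither their order π nor their signs εs matter, which lets the sum
      -- over W factor.
      head-• : ∀ π ε εs → head ((Perm.insert zero j π , ε Vec.∷ εs) • p) ≈ C ε
      head-• π ε εs = C-unique ε (begin
        head q * D ≈⟨ *-congˡ (trans (∏-permute (λ k → z p (punchIn j k) - z p j) π)
           (∏-cong {n} λ k → sym (+-cong (z-• σ δ p (suc k)) (-‿cong (z-• σ δ p zero))))) ⟩
        head q * (∏ λ k → z q (suc k) - z q zero) ≈⟨ head-z q ⟩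
        weight q zero * (∏ λ k → t * z q (suc k) - (t * t * x q zero + x⁻¹ q zero))
          ≈⟨ *-cong (weight-unique q zero x≈ x⁻¹≈ (w-inverse ε))
               (trans (∏-cong {n} λ k → +-cong (*-congˡ (z-• σ δ p (suc k))) (-‿cong (+-cong (*-congˡ x≈) x⁻¹≈)))
                 (sym (∏-permute (λ k → t * z p (punchIn j k) - (t * t * a + ā)) π))) ⟩
        w ε * (ā * (1# - s * (a * a))) * V ε ≈⟨ *-assoc _ _ _ ⟩
        N ε ∎)
        where
        σ = Perm.insert zero j π
        δ = ε Vec.∷ εs
        q = (σ , δ) • p
        a = x^± p j ε
        ā = x^± p j (not ε)
        x≈ : x q zero ≈ a
        x≈ = reflexive (x-• σ δ p zero)
        x⁻¹≈ : x⁻¹ q zero ≈ ā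
        x⁻¹≈ = x⁻¹-• σ δ p zero

      S-• : ∀ π ε εs → S ((Perm.insert zero j π , ε Vec.∷ εs) • p) ≈ C ε * S ((π , εs) • removeAt p j)
      S-• π ε εs = trans (S-suc q) (*-cong (head-• π ε εs) (S-cong (tail q) ((π , εs) • removeAt p j) λ i →
        trans (reflexive (≡.trans (x-tail q i) (x-• (Perm.insert zero j π) (ε Vec.∷ εs) p (suc i))))
          (trans (sym (x^±-removeAt p j (π ⟨$⟩ʳ i) (Vec.lookup εs i)))
            (reflexive (≡.sym (x-• π εs (removeAt p j) i))))))
        where
        q = (Perm.insert zero j π , ε Vec.∷ εs) • p

      B : Carrier
      B = C false + C true

      H≈B*D : eval (H (z p)) (- z p j) ≈ B * D
      H≈B*D = trans
        (H-root (z p) j (x*x⁻¹≈1 p j) (x⁻¹x≈1 p j) (w-inverse false) (w-inverse true) refl)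
        (sym (trans (distribʳ D _ _) (+-cong (C*D false) (C*D true))))

    F : ∀ {n} → GenericPoint n → Carrier
    F {n} p = ∑ (elementsOfW n) (λ w → S (w • p))

    F-suc : ∀ {n} (p : GenericPoint (suc n)) → F p ≈ sum (λ j → B p j * F (removeAt p j))
    F-suc {n} p = begin
      F p ≈⟨ ∑-product _,_ (permutations (suc n)) (signs (suc n)) (λ w → S (w • p)) ⟩
      ∑ (permutations (suc n)) (λ σ → ∑ (signs (suc n)) λ δ → S ((σ , δ) • p))
        ≈⟨ ∑-product (Perm.insert zero) (List.allFin (suc n)) (permutations n) (λ σ → ∑ (signs (suc n)) λ δ → S ((σ , δ) • p)) ⟩
      ∑ (List.allFin (suc n)) (λ j → ∑ (permutations n) λ π → ∑ (signs (suc n)) λ δ → S ((Perm.insert zero j π , δ) • p))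
        ≈⟨ ∑-cong (List.allFin (suc n)) row ⟩
      ∑ (List.allFin (suc n)) (λ j → B p j * F (removeAt p j))
        ≈⟨ ∑-tabulate id (λ j → B p j * F (removeAt p j)) ⟩
      sum (λ j → B p j * F (removeAt p j)) ∎
      where
      row : ∀ j → (∑ (permutations n) λ π → ∑ (signs (suc n)) λ δ → S ((Perm.insert zero j π , δ) • p))
                    ≈ B p j * F (removeAt p j)
      row j = begin
        (∑ (permutations n) λ π → ∑ (signs (suc n)) λ δ → S ((Perm.insert zero j π , δ) • p))
          ≈⟨ ∑-cong (permutations n) (λ π → ∑-product Vec._∷_ (false ∷ true ∷ []) (signs n)
               (λ δ → S ((Perm.insert zero j π , δ) • p))) ⟩
        (∑ (permutations n) λ π → ∑ (false ∷ true ∷ []) λ ε → ∑ (signs n) λ εs → S ((Perm.insert zero j π , ε Vec.∷ εs) • p))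
          ≈⟨ ∑-cong (permutations n) (λ π → trans (∑-cong (false ∷ true ∷ []) λ ε →
               trans (∑-cong (signs n) (S-• p j π ε)) (∑-*ˡ (signs n) (C p j ε) (rest π)))
               (solve 3 (λ c d f → c :* f :+ (d :* f :+ :0) := (c :+ d) :* f) refl _ _ _)) ⟩
        (∑ (permutations n) λ π → B p j * ∑ (signs n) (rest π))
          ≈⟨ ∑-*ˡ (permutations n) (B p j) (λ π → ∑ (signs n) (rest π)) ⟩
        B p j * (∑ (permutations n) λ π → ∑ (signs n) (rest π))
          ≈⟨ *-congˡ (sym (∑-product _,_ (permutations n) (signs n) (λ w → S (w • removeAt p j)))) ⟩
        B p j * F (removeAt p j) ∎
        where
        rest : Permutation′ n → Vec Bool n → Carrier
        rest π εs = S ((π , εs) • removeAt p j)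

    poch-suc : ∀ n → poch t t (suc n) ≈ poch t t n * (1# - t ^ suc n)
    poch-suc n = trans (∏-init-last {n} (λ i → 1# - t * t ^ toℕ i)) (*-cong
      (∏-cong {n} λ i → reflexive (≡.cong (λ k → 1# - t * t ^ k) (Fin.toℕ-inject₁ i)))
      (reflexive (≡.cong (λ k → 1# - t * t ^ k) (Fin.toℕ-fromℕ n))))

    open Sequences R t using (Sequence; T)

    module _ (σ : Sequence) (σ₀≈1 : σ (+ 0) ≈ 1#)
             (moment : ∀ {n} (z : Fin n → Carrier) →
                (1# - t) * apply T (H z) σ (+ 0) ≈ (1# - t ^ n) * apply T (E z) σ (+ 0)) where

      -- Adding the variable number n + 1 brings in the factor 1 - tⁿ⁺¹ of `moment`; together these
      -- factors build (t;t)ₙ, the numerator of v for (1ⁿ). Its denominator stays on the left as the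
      -- power of 1 - t.
      F≈ : ∀ n (p : GenericPoint n) → (1# - t) ^ n * F p ≈ poch t t n * apply T (E (z p)) σ (+ 0)
      F≈ zero    p = *-congˡ (trans (trans (+-identityʳ _) (S-0 _)) (sym (trans (apply-1 T (z p) σ (+ 0)) σ₀≈1)))
      F≈ (suc n) p = begin
        (1# - t) ^ suc n * F p ≈⟨ *-congˡ (F-suc p) ⟩
        (1# - t) * (1# - t) ^ n * sum (λ j → B p j * F (removeAt p j))
          ≈⟨ trans (*-assoc _ _ _) (*-congˡ (*-distribˡ-sum ((1# - t) ^ n) (λ j → B p j * F (removeAt p j)))) ⟩
        (1# - t) * sum (λ j → (1# - t) ^ n * (B p j * F (removeAt p j)))
          ≈⟨ *-congˡ (trans (sum-cong-≋ {suc n} term) (sym (*-distribˡ-sum (poch t t n) (λ j → B p j * Q (z p ∘ punchIn j))))) ⟩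
        (1# - t) * (poch t t n * sum (λ j → B p j * Q (z p ∘ punchIn j)))
          ≈⟨ *-congˡ (*-congˡ (sym (interpolation T (z p) (λ i≢j → #0-cancelˡ (z-z#0 p (i≢j ∘ ≡.sym)))
               (B p) (H (z p)) (H≈B*D p) σ (+ 0)))) ⟩
        (1# - t) * (poch t t n * apply T (H (z p)) σ (+ 0))
          ≈⟨ solve 3 (λ a b c → a :* (b :* c) := b :* (a :* c)) refl _ _ _ ⟩
        poch t t n * ((1# - t) * apply T (H (z p)) σ (+ 0))
          ≈⟨ *-congˡ (moment (z p)) ⟩
        poch t t n * ((1# - t ^ suc n) * Q (z p))
          ≈⟨ sym (*-assoc _ _ _) ⟩
        poch t t n * (1# - t ^ suc n) * Q (z p)
          ≈⟨ *-congʳ (sym (poch-suc n)) ⟩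
        poch t t (suc n) * Q (z p) ∎
        where
        Q : ∀ {m} → (Fin m → Carrier) → Carrier
        Q z = apply T (E z) σ (+ 0)
        term : ∀ j → (1# - t) ^ n * (B p j * F (removeAt p j)) ≈ poch t t n * (B p j * Q (z p ∘ punchIn j))
        term j = begin
          (1# - t) ^ n * (B p j * F (removeAt p j))
            ≈⟨ solve 3 (λ a b c → a :* (b :* c) := b :* (a :* c)) refl _ _ _ ⟩
          B p j * ((1# - t) ^ n * F (removeAt p j)) ≈⟨ *-congˡ (F≈ n (removeAt p j)) ⟩
          B p j * (poch t t n * Q (z (removeAt p j)))
            ≈⟨ *-congˡ (*-congˡ (apply-E-cong T (z-removeAt p j) σ (+ 0))) ⟩
          B p j * (poch t t n * Q (z p ∘ punchIn j))
            ≈⟨ solve 3 (λ a b c → a :* (b :* c) := b :* (a :* c)) refl _ _ _ ⟩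
          poch t t n * (B p j * Q (z p ∘ punchIn j)) ∎

-- Arithmetic of (1ⁿ), of parity and of the exponents

largest-ones : ∀ n → largest (ones (suc n)) ≡ 1
largest-ones zero    = ≡.refl
largest-ones (suc n) = ≡.cong (1 ℕ.⊔_) (largest-ones n)

mult-ones : ∀ n → mult (ones n) 1 ≡ n
mult-ones zero    = ≡.refl
mult-ones (suc n) = ≡.cong suc (mult-ones n)

n∸len-ones : ∀ n → n ℕ.∸ len (ones n) ≡ 0
n∸len-ones n = ≡.trans (≡.cong (n ℕ.∸_) (len-ones n)) (ℕ.n∸n≡0 n)

even-double : ∀ m → Even (+ (m ℕ.* 2)) × Even (ℤ.- + (m ℕ.* 2))
even-double m = ℤ.∣ᵤ⇒∣ (ℕ.divides m ≡.refl)
              , ℤ.∣ᵤ⇒∣ (ℕ.divides m (ℤ.∣-i∣≡∣i∣ (+ (m ℕ.* 2))))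

odd-double : ∀ {y} m → ∣ y ∣ ≡ suc (m ℕ.* 2) → ¬ Even y
odd-double m eq even
  with () ← ℕ.∣1⇒≡1 (ℕ.∣m+n∣m⇒∣n
         (≡.subst (2 ℕ.∣_) (≡.trans eq (ℕ.+-comm 1 (m ℕ.* 2))) (ℤ.∣⇒∣ᵤ even)) (ℕ.divides m ≡.refl))

-[q*k] : ∀ q k → ℤ.- (+ q ℤ.* + k) ≡ ℤ.- + (q ℕ.* k)
-[q*k] q k = ≡.cong ℤ.-_ (≡.sym (ℤ.pos-* q k))

-[q*-k] : ∀ q k → ℤ.- (+ q ℤ.* ℤ.- + k) ≡ + (q ℕ.* k)
-[q*-k] q k = ≡.trans (≡.cong ℤ.-_ (≡.sym (ℤ.neg-distribʳ-* (+ q) (+ k))))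
  (≡.trans (ℤ.neg-involutive _) (≡.sym (ℤ.pos-* q k)))

[a+b]-b : ∀ a b → + (a ℕ.+ b) ℤ.- + b ≡ + a
[a+b]-b a b = ≡.trans (≡.cong (ℤ._- + b) (ℤ.pos-+ a b)) (≡.trans (ℤ.+-assoc (+ a) (+ b) (ℤ.- + b))
  (≡.trans (≡.cong (ℤ._+_ (+ a)) (ℤ.+-inverseʳ (+ b))) (ℤ.+-identityʳ (+ a))))

∣2k²-k∣ : ∀ m → ∣ + 2 ℤ.* (+ suc m ℤ.* + suc m) ℤ.- + suc m ∣ ≡ suc m ℕ.* (1 ℕ.+ m ℕ.* 2)
∣2k²-k∣ m = ≡.cong ∣_∣ (≡.trans (≡.cong (ℤ._- + suc m) (≡.trans (≡.sym (ℤ.pos-* 2 (suc m ℕ.* suc m)))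
  (≡.cong +_ (ℕ-solve 1 (λ m → # 2 ⊠ ((# 1 ⊞ m) ⊠ (# 1 ⊞ m)) ≣ (# 1 ⊞ m) ⊠ (# 1 ⊞ m ⊠ # 2) ⊞ (# 1 ⊞ m)) ≡.refl m))))
  ([a+b]-b (suc m ℕ.* (1 ℕ.+ m ℕ.* 2)) (suc m)))

∣2k²+k∣ : ∀ m → ∣ + 2 ℤ.* (-[1+ m ] ℤ.* -[1+ m ]) ℤ.- -[1+ m ] ∣ ≡ suc m ℕ.* (3 ℕ.+ m ℕ.* 2)
∣2k²+k∣ m = ≡.cong ∣_∣ (≡.trans (≡.cong (ℤ._+ + suc m) (≡.sym (ℤ.pos-* 2 (suc m ℕ.* suc m))))
  (≡.cong +_ (ℕ-solve 1 (λ m → # 2 ⊠ ((# 1 ⊞ m) ⊠ (# 1 ⊞ m)) ⊞ (# 1 ⊞ m) ≣ (# 1 ⊞ m) ⊠ (# 3 ⊞ m ⊠ # 2)) ≡.refl m)))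

∣k²-k∣ : ∀ m → ∣ + suc m ℤ.* + suc m ℤ.- + suc m ∣ ≡ suc m ℕ.* m
∣k²-k∣ m = ≡.cong ∣_∣ (≡.trans (≡.cong (ℤ._- + suc m) (≡.trans (≡.sym (ℤ.pos-* (suc m) (suc m)))
  (≡.cong +_ (ℕ-solve 1 (λ m → (# 1 ⊞ m) ⊠ (# 1 ⊞ m) ≣ (# 1 ⊞ m) ⊠ m ⊞ (# 1 ⊞ m)) ≡.refl m))))
  ([a+b]-b (suc m ℕ.* m) (suc m)))

∣k²+k∣ : ∀ m → ∣ -[1+ m ] ℤ.* -[1+ m ] ℤ.- -[1+ m ] ∣ ≡ suc m ℕ.* (2 ℕ.+ m)
∣k²+k∣ m = ℕ-solve 1 (λ m → (# 1 ⊞ m) ⊠ (# 1 ⊞ m) ⊞ (# 1 ⊞ m) ≣ (# 1 ⊞ m) ⊠ (# 2 ⊞ m)) ≡.refl m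

-- Expansion in the functions ė and the sums over y

module Expansion {c ℓ₁ ℓ₂} (K : HeytingField c ℓ₁ ℓ₂) where

  open HeytingField K using (Carrier; _≈_; _#_)
  open HallLittlewood K
  open FieldLemmas K
  open WeylSum K using (S; summand≈S; F; F≈)
  open CommutativeRing R hiding (zero; Carrier; _≈_)
  open import Relation.Binary.Reasoning.Setoid setoid
  open IntegerSolver R using (solve; _:+_; _:*_; _:-_; :-_; _:=_; :1; combine₁)
  open Polynomials R hiding (product)

  -- A variable μ with two equations as hypotheses keeps `n ∸ len μ` and `largest μ` in a form that
  -- `rewrite` can replace throughout the goal, including the apartness proofs inside the divisions.
  normaliser-ones : ∀ {n} μ t (1#t : 1# # t) s₁ s₂ → n ℕ.∸ len μ ≡ 0 → largest μ ≡ 1 →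
    normaliserBC n μ t 1#t s₁ s₂ * (1# - t) ^ mult μ 1 ≈ poch t t (mult μ 1)
  normaliser-ones μ t 1#t s₁ s₂ n∸len≡0 largest≡1 rewrite n∸len≡0 | largest≡1 = begin
    1# * ((1# ÷ 1# [ ^-#0 1-t#0 0 ]) * (r * 1#)) * (1# - t) ^ m
      ≈⟨ solve 3 (λ u r b → :1 :* (u :* (r :* :1)) :* b := u :* :1 :* (r :* b)) refl _ _ _ ⟩
    (1# ÷ 1# [ ^-#0 1-t#0 0 ]) * 1# * (r * (1# - t) ^ m)
      ≈⟨ *-cong (÷-* 1# (^-#0 1-t#0 0)) (÷-* (poch t t m) (^-#0 1-t#0 m)) ⟩
    1# * poch t t m ≈⟨ *-identityˡ _ ⟩
    poch t t m ∎
    where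
    m = mult μ 1
    1-t#0 : 1# - t # 0#
    1-t#0 = #⇒-#0 1#t
    r = poch t t m ÷ (1# - t) ^ m [ ^-#0 1-t#0 m ]

  e-suc : ∀ r a as → e (suc r) (a ∷ as) ≈ a * e r as + e (suc r) as
  e-suc r a as = trans (∑-++ (List.map (a ∷_) (sublistsOfLength r as)) _ _)
    (+-congʳ (trans (∑-map (a ∷_) (sublistsOfLength r as) _) (∑-*ˡ (sublistsOfLength r as) a _)))

  -- Extension by zero to negative indices makes the recursion `eℤ-∷` valid at every integer, so
  -- that shifts of the index need no case distinction.
  eℤ : ℤ → List Carrier → Carrier
  eℤ (+ r)      as = e r as
  eℤ (-[1+ _ ]) as = 0#

  eℤ-∷ : ∀ k a as → eℤ k (a ∷ as) ≈ a * eℤ (ℤ.pred k) as + eℤ k as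
  eℤ-∷ (+ zero)    a as = sym (trans (+-congʳ (zeroʳ a)) (+-identityˡ _))
  eℤ-∷ (+ suc r)   a as = e-suc r a as
  eℤ-∷ (-[1+ r ])  a as = sym (trans (+-congʳ (zeroʳ a)) (+-identityˡ _))

  module _ (t : Carrier) where

    open Sequences R t
    open Moments R t
    open Pairing R t

    module _ {n} (p : GenericPoint n) where

      variables : ∀ {m} → (Fin m → Fin n) → List Carrier
      variables h = List.concatMap (λ i → x p i ∷ x⁻¹ p i ∷ []) (List.tabulate h)

      -- Generating functions: (1 + x u)(1 + x⁻¹ u) = u (ζ + z), so m pairs of variables give uᵐ ∏ᵢ
      -- (ζ + zᵢ), whence the shift of the index by m.
      eℤ-coefficients : ∀ m (h : Fin m → Fin n) i → eℤ (+ m ℤ.+ i) (variables h) ≈ coefficients (z p ∘ h) i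
      eℤ-coefficients zero h i = trans (trans (reflexive (≡.cong (λ k → eℤ k []) (ℤ.+-identityˡ i))) (base i))
        (sym (apply-1 T (z p ∘ h) δ i))
        where
        base : ∀ i → eℤ i [] ≈ δ i
        base (+ zero)   = +-identityʳ 1#
        base (+ suc r)  = refl
        base (-[1+ r ]) = refl
      eℤ-coefficients (suc m) h i = begin
        eℤ k (a ∷ b ∷ as)
          ≈⟨ trans (eℤ-∷ k a (b ∷ as)) (+-cong (*-congˡ (eℤ-∷ (down k) b as)) (eℤ-∷ k b as)) ⟩
        a * (b * eℤ (down (down k)) as + eℤ (down k) as) + (b * eℤ (down k) as + eℤ k as)
          ≈⟨ combine₁ (eℤ (down (down k)) as) (x*x⁻¹≈1 p (h zero))
               (solve 5 (λ a b f g h → a :* (b :* f :+ g) :+ (b :* g :+ h) :- ((a :+ b) :* g :+ (h :+ f))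
                 := f :* (a :* b :- :1)) refl a b _ _ _) ⟩
        (a + b) * eℤ (down k) as + (eℤ k as + eℤ (down (down k)) as)
          ≈⟨ +-cong (*-congˡ (at (down k) i down-k)) (+-cong (at k (up i) k≡) (at (down (down k)) (down i)
               (≡.trans (≡.cong down down-k) down-+))) ⟩
        z p (h zero) * coefficients z′ i + op T (coefficients z′) i
          ≈⟨ sym (apply-E T (z p ∘ h) δ i) ⟩
        coefficients (z p ∘ h) i ∎
        where
        k  = + suc m ℤ.+ i
        a  = x p (h zero)
        b  = x⁻¹ p (h zero)
        as = variables (h ∘ suc)
        z′ = z p ∘ h ∘ suc
        at : ∀ k i → k ≡ + m ℤ.+ i → eℤ k as ≈ coefficients z′ i
        at k i k≡ = trans (reflexive (≡.cong (λ k → eℤ k as) k≡)) (eℤ-coefficients m (h ∘ suc) i)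
        k≡ : k ≡ + m ℤ.+ up i
        k≡ = ≡.trans (≡.cong (ℤ._+ i) (ℤ.+-comm (+ 1) (+ m))) (ℤ.+-assoc (+ m) (+ 1) i)
        down-k : down k ≡ + m ℤ.+ i
        down-k = ≡.trans (≡.cong down (ℤ.+-assoc (+ 1) (+ m) i)) (ℤ.pred-suc (+ m ℤ.+ i))
        down-+ : down (+ m ℤ.+ i) ≡ + m ℤ.+ down i
        down-+ = ≡.trans (≡.sym (ℤ.+-assoc ℤ.-1ℤ (+ m) i)) (≡.trans (≡.cong (ℤ._+ i) (ℤ.+-comm ℤ.-1ℤ (+ m)))
          (ℤ.+-assoc (+ m) ℤ.-1ℤ i))

      cf : Sequence
      cf = coefficients (z p)

      ė-coefficients : ∀ i → ė (+ n ℤ.+ i) p ≈ cf i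
      ė-coefficients i = trans (ė≡eℤ (+ n ℤ.+ i)) (eℤ-coefficients n id i)
        where
        ė≡eℤ : ∀ k → ė k p ≈ eℤ k (variables id)
        ė≡eℤ (+ r)      = refl
        ė≡eℤ (-[1+ r ]) = refl

      term : ∀ {E E′} q y {i} → E ≡ E′ → ℤ.- (q ℤ.* y) ≡ i →
             t ^ E * (ė (+ n ℤ.- q ℤ.* y) p - ė (+ n ℤ.+ + 2 ℤ.- q ℤ.* y) p)
               ≈ t ^ E′ * (cf i - cf (+ 2 ℤ.+ i))
      term q y {i} ≡.refl ≡.refl = *-congˡ (+-cong (ė-coefficients i)
        (-‿cong (trans (reflexive (≡.cong (λ k → ė k p) (ℤ.+-assoc (+ n) (+ 2) i))) (ė-coefficients (+ 2 ℤ.+ i)))))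

      -- For y > 0 the index - q y is negative; symmetry of `cf` folds it to k = q y - 2 and
      -- reverses the difference. The sign that this costs is the sign of `ℓ₀` and `ℓₜ` at the
      -- indices 4m + 2, so the sums over y carry none.
      term⁺ : ∀ {E E′} q y k → E ≡ E′ → ℤ.- (q ℤ.* y) ≡ ⁻ (2 ℕ.+ k) →
              t ^ E * (ė (+ n ℤ.- q ℤ.* y) p - ė (+ n ℤ.+ + 2 ℤ.- q ℤ.* y) p)
                ≈ - t ^ E′ * Δ cf (+ k)
      term⁺ {E′ = E′} q y k E≡ i≡ = trans (term q y E≡ i≡) (trans
        (*-congˡ (+-cong (sym′ (2 ℕ.+ k)) (-‿cong (trans (reflexive (≡.cong cf (2-[2+k] k))) (sym′ k)))))
        (solve 3 (λ τ a b → τ :* (a :- b) := :- τ :* (b :- a)) refl _ _ _))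
        where
        sym′ : Symmetric cf
        sym′ = coefficients-symmetric (z p)
        2-[2+k] : ∀ k → + 2 ℤ.+ ⁻ (2 ℕ.+ k) ≡ ⁻ k
        2-[2+k] zero    = ≡.refl
        2-[2+k] (suc k) = ≡.refl

      Δ-vanish : ∀ k → n ℕ.< k → ∀ a → a * Δ cf (+ k) ≈ 0#
      Δ-vanish k n<k a = trans (*-congˡ (trans (+-cong (bd k n<k) (-‿cong (bd (2 ℕ.+ k) (ℕ.m≤n⇒m≤o+n 2 n<k))))
        (-‿inverseʳ 0#))) (zeroʳ a)
        where
        bd : Bounded n cf
        bd = coefficients-bounded (z p)

    ∑-upTo : ∀ N (h : ℕ → Carrier) → ∑ (List.upTo N) h ≈ Σ< N h
    ∑-upTo N h = go N id
      where
      go : ∀ N (g : ℕ → ℕ) → ∑ (List.applyUpTo g N) h ≈ Σ< N (h ∘ g)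
      go zero    g = refl
      go (suc N) g = trans (+-congˡ (go N (g ∘ suc))) (sym (Σ<-cons N (h ∘ g)))

    ∑-interval : ∀ N f → ∑ (interval N) f ≈ f (+ 0) + Σ< N (λ m → f (+ suc m) + f (-[1+ m ]))
    ∑-interval N f = begin
      ∑ (interval N) f
        ≈⟨ trans (∑-++ (List.map +_ (List.upTo (suc N))) _ f)
             (+-cong (trans (∑-map +_ (List.upTo (suc N)) f) (∑-upTo (suc N) (f ∘ +_)))
                     (trans (∑-map -[1+_] (List.upTo N) f) (∑-upTo N (f ∘ -[1+_])))) ⟩
      Σ< (suc N) (f ∘ +_) + Σ< N (f ∘ -[1+_])
        ≈⟨ trans (+-congʳ (Σ<-cons N (f ∘ +_))) (+-assoc _ _ _) ⟩
      f (+ 0) + (Σ< N (λ m → f (+ suc m)) + Σ< N (f ∘ -[1+_]))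
        ≈⟨ +-congˡ (sym (Σ<-+ N (λ m → f (+ suc m)) (f ∘ -[1+_]))) ⟩
      f (+ 0) + Σ< N (λ m → f (+ suc m) + f (-[1+ m ])) ∎

    ∑-filter : ∀ {ℓ} {P : Pred ℤ ℓ} (P? : Decidable P) as f →
               ∑ (List.filter P? as) f ≈ ∑ as (λ y → if does (P? y) then f y else 0#)
    ∑-filter P? []       f = refl
    ∑-filter P? (a ∷ as) f with does (P? a)
    ... | true  = +-congˡ (∑-filter P? as f)
    ... | false = trans (∑-filter P? as f) (sym (+-identityˡ _))

    Σ<-double : ∀ M (h : ℕ → Carrier) → (∀ m → h (m ℕ.* 2) ≈ 0#) → Σ< (M ℕ.* 2) h ≈ Σ< M (λ m → h (1 ℕ.+ m ℕ.* 2))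
    Σ<-double zero    h even≈0 = refl
    Σ<-double (suc M) h even≈0 = +-congʳ (trans (+-cong (Σ<-double M h even≈0) (even≈0 M)) (+-identityʳ _))

    ∑-even : ∀ M f → ∑ (List.filter even? (interval (M ℕ.* 2))) f
                       ≈ f (+ 0) + Σ< M (λ m → f (+ (2 ℕ.+ m ℕ.* 2)) + f (-[1+ 1 ℕ.+ m ℕ.* 2 ]))
    ∑-even M f = trans (∑-filter even? (interval (M ℕ.* 2)) f) (trans (∑-interval (M ℕ.* 2) g)
      (+-cong (even (+ 0) (proj₁ (even-double 0))) (trans
        (Σ<-double M _ λ m → trans (+-cong (odd (+ suc (m ℕ.* 2)) (odd-double m ≡.refl))
                                           (odd -[1+ m ℕ.* 2 ] (odd-double m ≡.refl))) (+-identityʳ 0#))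
        (Σ<-cong M λ m → +-cong (even (+ (2 ℕ.+ m ℕ.* 2)) (proj₁ (even-double (suc m))))
                                (even -[1+ 1 ℕ.+ m ℕ.* 2 ] (proj₂ (even-double (suc m))))))))
      where
      g : ℤ → Carrier
      g y = if does (even? y) then f y else 0#
      even : ∀ y → Even y → g y ≈ f y
      even y ev = reflexive (≡.cong (if_then f y else 0#) (dec-true (even? y) ev))
      odd : ∀ y → ¬ Even y → g y ≈ 0#
      odd y ¬ev = reflexive (≡.cong (if_then f y else 0#) (dec-false (even? y) ¬ev))

    module _ (1#t : 1# # t) {n} (p : GenericPoint (suc n)) (s₁ s₂ s : Carrier)
             (s₁s₂ : ∀ a → (1# - s₁ * a) * (1# - s₂ * a) ≈ 1# - s * (a * a))
             (nz : normaliserBC (suc n) (ones (suc n)) t 1#t s₁ s₂ # 0#)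
             (ℓ : ℕ → Carrier) (ℓ0≈1 : ℓ 0 ≈ 1#)
             (ℓ-odd : ∀ m → ℓ (1 ℕ.+ m ℕ.* 4) ≈ 0# × ℓ (3 ℕ.+ m ℕ.* 4) ≈ 0#)
             (moment : ∀ {n} (z : Fin n → Carrier) →
                (1# - t) * apply T (Recursion.H R t s z) (antisymmetric ℓ) (+ 0)
                  ≈ (1# - t ^ n) * apply T (E z) (antisymmetric ℓ) (+ 0)) where

      private
        N = suc n
        μ = ones N
        σ = antisymmetric ℓ
        P = PBC μ (len-ones≤ N) t 1#t s₁ s₂ nz p

      -- For (1ⁿ) the normaliser is (t;t)ₙ / (1 - t)ⁿ, so after multiplication by it and by the
      -- power of 1 - t the claim becomes `F≈`.
      P≈Q : P ≈ apply T (E (z p)) σ (+ 0)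
      P≈Q = sym (÷-unique nz (#0-cancelˡ (^-#0 (#⇒-#0 1#t) N) (begin
        (1# - t) ^ N * (Q * norm)
          ≈⟨ solve 3 (λ a b c → a :* (b :* c) := c :* a :* b) refl _ _ _ ⟩
        norm * (1# - t) ^ N * Q
          ≈⟨ *-congʳ (≡.subst (λ m → norm * (1# - t) ^ m ≈ poch t t m) (mult-ones N)
               (normaliser-ones {N} μ t 1#t s₁ s₂ (n∸len-ones N) (largest-ones n))) ⟩
        poch t t N * Q ≈⟨ sym (F≈ t s₁ s₂ s s₁s₂ σ ℓ0≈1 moment N p) ⟩
        (1# - t) ^ N * F t s₁ s₂ s s₁s₂ p
          ≈⟨ *-congˡ (∑-cong (elementsOfW N) λ w → trans
               (reflexive (≡.cong (S t s₁ s₂ s s₁s₂) (•≡act w p)))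
               (sym (summand≈S t s₁ s₂ s s₁s₂ (act w p)))) ⟩
        (1# - t) ^ N * ∑ (elementsOfW N) (λ w → (w · summandBC μ t s₁ s₂) p) ∎)))
        where
        Q = apply T (E (z p)) σ (+ 0)
        norm = normaliserBC N μ t 1#t s₁ s₂

      P≈blocks : ∀ M → N ℕ.≤ M → P ≈ 1# * Δ (cf p) (+ 0)
                   + Σ< M (λ m → ℓ (2 ℕ.+ m ℕ.* 4) * Δ (cf p) (+ (2 ℕ.+ m ℕ.* 4))
                               + ℓ (4 ℕ.+ m ℕ.* 4) * Δ (cf p) (+ (4 ℕ.+ m ℕ.* 4)))
      P≈blocks M N≤M = begin
        P ≈⟨ P≈Q ⟩
        apply T (E (z p)) σ (+ 0)
          ≈⟨ pairing-coefficients (1 ℕ.+ M ℕ.* 4) (z p) (antisymmetric-antisymmetric ℓ)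
               (s≤s (ℕ.≤-trans N≤M (ℕ.m≤m*n M 4))) ⟩
        pairing (1 ℕ.+ M ℕ.* 4) σ (cf p)
          ≈⟨ Σ<-cong (1 ℕ.+ M ℕ.* 4) (λ r → *-congʳ (antisymmetric-⁻ ℓ r)) ⟩
        Σ< (1 ℕ.+ M ℕ.* 4) (λ r → ℓ r * Δ (cf p) (+ r))
          ≈⟨ Σ<-blocks M (λ r → ℓ r * Δ (cf p) (+ r)) (λ m →
               trans (*-congʳ (proj₁ (ℓ-odd m))) (zeroˡ _) , trans (*-congʳ (proj₂ (ℓ-odd m))) (zeroˡ _)) ⟩
        ℓ 0 * Δ (cf p) (+ 0) + _
          ≈⟨ +-congʳ (*-congʳ ℓ0≈1) ⟩
        _ ∎

    factorisation : ∀ {√s s} → √s * √s ≈ s → ∀ a → (1# - √s * a) * (1# - - √s * a) ≈ 1# - s * (a * a)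
    factorisation {√s} {s} √s²≈s a = combine₁ (- (a * a)) √s²≈s
      (solve 3 (λ r s a → (:1 :- r :* a) :* (:1 :- :- r :* a) :- (:1 :- s :* (a :* a))
         := (:- (a :* a)) :* (r :* r :- s)) refl √s s a)

    module _ {n} (p : GenericPoint n) where

      f₀ fₜ : ℤ → Carrier
      f₀ y = t ^ ∣ + 2 ℤ.* (y ℤ.* y) ℤ.- y ∣ * (ė (+ n ℤ.- + 4 ℤ.* y) p - ė (+ n ℤ.+ + 2 ℤ.- + 4 ℤ.* y) p)
      fₜ y = t ^ ∣ y ℤ.* y ℤ.- y ∣ * (ė (+ n ℤ.- + 2 ℤ.* y) p - ė (+ n ℤ.+ + 2 ℤ.- + 2 ℤ.* y) p)

      f₀-+ : ∀ m → f₀ (+ suc m) ≈ ℓ₀ (2 ℕ.+ m ℕ.* 4) * Δ (cf p) (+ (2 ℕ.+ m ℕ.* 4))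
      f₀-+ m = trans (term⁺ p (+ 4) (+ suc m) (2 ℕ.+ m ℕ.* 4) (∣2k²-k∣ m)
          (≡.trans (-[q*k] 4 (suc m)) (≡.cong (λ k → ℤ.- + k) (ℕ.*-comm 4 (suc m)))))
        (*-congʳ (sym (proj₁ (ℓ₀-even m))))

      f₀-- : ∀ m → f₀ (-[1+ m ]) ≈ ℓ₀ (4 ℕ.+ m ℕ.* 4) * Δ (cf p) (+ (4 ℕ.+ m ℕ.* 4))
      f₀-- m = trans (term p (+ 4) (-[1+ m ]) (∣2k²+k∣ m)
          (≡.trans (-[q*-k] 4 (suc m)) (≡.cong +_ (ℕ.*-comm 4 (suc m)))))
        (*-congʳ (sym (proj₂ (ℓ₀-even m))))

      fₜ-+ : ∀ m → fₜ (+ (2 ℕ.+ m ℕ.* 2)) ≈ ℓₜ (2 ℕ.+ m ℕ.* 4) * Δ (cf p) (+ (2 ℕ.+ m ℕ.* 4))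
      fₜ-+ m = trans (term⁺ p (+ 2) (+ (2 ℕ.+ m ℕ.* 2)) (2 ℕ.+ m ℕ.* 4) (∣k²-k∣ (1 ℕ.+ m ℕ.* 2))
          (≡.trans (-[q*k] 2 (2 ℕ.+ m ℕ.* 2)) (≡.cong (λ k → ℤ.- + k)
            (ℕ-solve 1 (λ m → # 2 ⊠ (# 2 ⊞ m ⊠ # 2) ≣ # 4 ⊞ m ⊠ # 4) ≡.refl m))))
        (*-congʳ (sym (proj₁ (ℓₜ-even m))))

      fₜ-- : ∀ m → fₜ (-[1+ 1 ℕ.+ m ℕ.* 2 ]) ≈ ℓₜ (4 ℕ.+ m ℕ.* 4) * Δ (cf p) (+ (4 ℕ.+ m ℕ.* 4))
      fₜ-- m = trans (term p (+ 2) (-[1+ 1 ℕ.+ m ℕ.* 2 ]) (∣k²+k∣ (1 ℕ.+ m ℕ.* 2))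
          (≡.trans (-[q*-k] 2 (2 ℕ.+ m ℕ.* 2)) (≡.cong +_
            (ℕ-solve 1 (λ m → # 2 ⊠ (# 2 ⊞ m ⊠ # 2) ≣ # 4 ⊞ m ⊠ # 4) ≡.refl m))))
        (*-congʳ (sym (proj₂ (ℓₜ-even m))))

      f₀-vanish : ∀ y → n ℕ.< ∣ y ∣ → f₀ y ≈ 0#
      f₀-vanish (+ suc m)  n<y = trans (f₀-+ m)
        (Δ-vanish p (2 ℕ.+ m ℕ.* 4) (ℕ.≤-trans n<y (s≤s (ℕ.m≤n⇒m≤1+n (ℕ.m≤m*n m 4)))) _)
      f₀-vanish (-[1+ m ]) n<y = trans (f₀-- m)
        (Δ-vanish p (4 ℕ.+ m ℕ.* 4) (ℕ.≤-trans n<y (s≤s (ℕ.m≤n⇒m≤o+n 3 (ℕ.m≤m*n m 4)))) _)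

      fₜ-vanish : ∀ y → Even y → n ℕ.* 2 ℕ.< ∣ y ∣ → fₜ y ≈ 0#
      fₜ-vanish (+ suc m) even n<y = trans (term⁺ p (+ 2) (+ suc m) (m ℕ.* 2) (∣k²-k∣ m)
          (≡.trans (-[q*k] 2 (suc m)) (≡.cong (λ k → ℤ.- + k) (ℕ.*-comm 2 (suc m)))))
        (Δ-vanish p (m ℕ.* 2) (bound m even n<y) _)
        where
        bound : ∀ m → Even (+ suc m) → n ℕ.* 2 ℕ.< suc m → n ℕ.< m ℕ.* 2
        -- The case m = 0 is y = 1, where the bound fails even for n = 0; parity excludes it.
        bound zero    even _   with () ← odd-double 0 ≡.refl even
        bound (suc m) _    n<y = s≤s (ℕ.≤-trans (ℕ.m≤m*n n 2)
          (ℕ.≤-trans (ℕ.s≤s⁻¹ n<y) (s≤s (ℕ.m≤m*n m 2))))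
      fₜ-vanish (-[1+ m ]) even n<y = trans (term p (+ 2) (-[1+ m ]) (∣k²+k∣ m)
          (≡.trans (-[q*-k] 2 (suc m)) (≡.cong +_ (ℕ.*-comm 2 (suc m)))))
        (Δ-vanish p (2 ℕ.+ m ℕ.* 2) (ℕ.≤-<-trans (ℕ.m≤m*n n 2)
          (ℕ.≤-trans n<y (s≤s (ℕ.m≤n⇒m≤1+n (ℕ.m≤m*n m 2))))) _)

lemma4p2 : ∀ {c ℓ₁ ℓ₂} (K : HeytingField c ℓ₁ ℓ₂) →
    let open HeytingField K
        open HallLittlewood K
    in
    (n : ℕ) → n ≥ 1 → (x : GenericPoint n) (t : Carrier) (1#t : 1# # t) →
    ((√0 : Carrier) (√0²≈0 : √0 * √0 ≈ 0#)
     (nz : normaliserBC n (ones n) t 1#t √0 (- √0) # 0#) →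
     IsSum U?
       (λ y → t ^ ∣ + 2 ℤ.* (y ℤ.* y) ℤ.- y ∣
            * (ė (+ n ℤ.- + 4 ℤ.* y) x - ė (+ n ℤ.+ + 2 ℤ.- + 4 ℤ.* y) x))
       (PC (ones n) (len-ones≤ n) t 1#t 0# √0 √0²≈0 nz x))
    ×
    ((√t : Carrier) (√t²≈t : √t * √t ≈ t)
     (nz : normaliserBC n (ones n) t 1#t √t (- √t) # 0#) →
     IsSum even?
       (λ y → t ^ ∣ y ℤ.* y ℤ.- y ∣
            * (ė (+ n ℤ.- + 2 ℤ.* y) x - ė (+ n ℤ.+ + 2 ℤ.- + 2 ℤ.* y) x))
       (PC (ones n) (len-ones≤ n) t 1#t t √t √t²≈t nz x))
lemma4p2 K (suc n) _ p t 1#t =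
    (λ √0 √0²≈0 nz → N , (λ y _ → f₀-vanish t p y) , trans
      (P≈blocks t 1#t p √0 (- √0) 0# (factorisation t √0²≈0) nz ℓ₀ refl ℓ₀-odd
        (Case-0.moment (antisymmetric ℓ₀) (antisymmetric-antisymmetric ℓ₀) refl twisted₀) N ℕ.≤-refl)
      (sym (trans (∑-filter t U? (interval N) (f₀ t p)) (trans (∑-interval t N (f₀ t p))
        (+-cong (term t p {0} (+ 4) (+ 0) ≡.refl ≡.refl) (Σ<-cong N λ m → +-cong (f₀-+ t p m) (f₀-- t p m)))))))
  -- Again N blocks of four are taken, but they now belong to y = ±2, ±4, ..., ±2N, so the interval
  -- has to reach 2N.
  , (λ √t √t²≈t nz → N ℕ.* 2 , fₜ-vanish t p , trans
      (P≈blocks t 1#t p √t (- √t) t (factorisation t √t²≈t) nz ℓₜ refl ℓₜ-odd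
        (Case-t.moment (antisymmetric ℓₜ) (antisymmetric-antisymmetric ℓₜ) twistedₜ) N ℕ.≤-refl)
      (sym (trans (∑-even t N (fₜ t p))
        (+-cong (term t p {0} (+ 2) (+ 0) ≡.refl ≡.refl) (Σ<-cong N λ m → +-cong (fₜ-+ t p m) (fₜ-- t p m))))))
  where
  N = suc n
  open HeytingField K using (-_; 0#; refl; sym; trans; +-cong)
  open FieldLemmas K using (R)
  open Expansion K
  open Moments R t
  open Pairing R t
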